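{- Let $G$ and $H$ be finitely generated groups, and let $G*H$ be their free product. Then \[ \operatorname{sep}_{G*H}(r)\simeq \max\{\operatorname{sep}_G(r),\operatorname{sep}_H(r)\}. \]
   Context: For a finite graph $\Gamma=(V\Gamma,E\Gamma)$, the cutsize $\operatorname{cut}(\Gamma)$ is the minimum cardinality of a subset $S\subseteq V\Gamma$ such that every connected component of $\Gamma-S$ contains at most $\frac12|V\Gamma|$ vertices. For any graph $X$, the separation profile of $X$ is the function $\operatorname{sep}_X:\mathbb N\to\mathbb N$, \[ \operatorname{sep}_X(r)=\max\{\operatorname{cut}(\Gamma) : \Gamma\leq X,\ |V\Gamma|\leq r\}, \] where $\Gamma\leq X$ means $\Gamma$ is a (finite) subgraph of $X$. For functions $f,g:\mathbb N\to\mathbb N$, write $f\lesssim g$ if there is a constant $C$ such that $f(r)\leq Cg(Cr)+C$ for all $r\in\mathbb N$, and $f\simeq g$ if $f\lesssim g$ and $g\lesssim f$. For a finitely generated group $G$, $\operatorname{sep}_G$ denotes the separation profile of a Cayley graph of $G$ with respect to a finite generating set. It is considered up to $\simeq$, and up to $\simeq$ it does not depend on the choice of finite generating set. -}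

module Defs where

open import Level using (Level; 0ℓ; _⊔_) renaming (suc to lsuc)
open import Algebra.Bundles using (Group)
open import Axiom.ExcludedMiddle using (ExcludedMiddle)
open import Data.Empty using (⊥-elim)
open import Data.Fin.Base using (Fin)
open import Data.Fin.Subset using (Subset; _∈_; _∉_; ∣_∣; ⊤)
open import Data.Fin.Subset.Properties using (∈⊤; ∣⊤∣≡n)
open import Data.List.Base using (List; []; _∷_; [_]; _++_)
open import Data.List.Properties using (++-assoc; ++-identityʳ)
open import Data.Nat.Base using (ℕ; zero; suc; _+_; _*_; _≤_; z≤n)
open import Data.Nat.Properties using (≤-trans; ≤-pred; m≤n⇒m<n∨m≡n)
open import Data.Product.Base using (Σ; ∃; _×_; _,_; proj₁; proj₂)
open import Data.Sum.Base using (_⊎_; inj₁; inj₂; swap)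
open import Data.Vec.Base as Vec using ()
open import Function.Base using (_∘_)
open import Function.Bundles using (_⇔_)
open import Function.Definitions using (Injective)
open import Relation.Binary.Bundles using (Setoid)
open import Relation.Binary.Core using (Rel)
open import Relation.Binary.Definitions
  using (Symmetric; Irreflexive; Decidable; _Respects₂_)
open import Relation.Binary.Construct.Closure.ReflexiveTransitive using (Star)
open import Relation.Binary.PropositionalEquality.Core as ≡ using (_≡_)
open import Relation.Nullary using (¬_; yes; no)

private
  variable
    c c₁ c₂ e ℓ ℓ₁ ℓ₂ p v : Level

------------------------------------------------------------------------
-- Graphs are simple and undirected, and may be infinite.

record Graph v ℓ e : Set (lsuc (v ⊔ ℓ ⊔ e)) where
  field
    vertices : Setoid v ℓ

  open Setoid vertices public
    renaming (Carrier to Vertex; refl to ≈-refl; sym to ≈-sym; trans to ≈-trans)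
    using (_≈_)

  field
    _~_      : Rel Vertex e
    ~-resp   : _~_ Respects₂ _≈_
    ~-sym    : Symmetric _~_
    ~-irrefl : Irreflexive _≈_ _~_

record FiniteGraph : Set₁ where
  field
    order    : ℕ
    _~_      : Rel (Fin order) 0ℓ
    ~-dec    : Decidable _~_
    ~-sym    : Symmetric _~_
    ~-irrefl : Irreflexive _≡_ _~_

-- A finite subgraph, presented by an enumeration of its vertices without
-- repetition.  It need not be induced.

infix 4 _≤ᴳ_

record _≤ᴳ_ (Γ : FiniteGraph) (X : Graph v ℓ e) : Set (v ⊔ ℓ ⊔ e) where
  private
    module Γ = FiniteGraph Γ
    module X = Graph X
  field
    embed     : Fin Γ.order → X.Vertex
    injective : Injective _≡_ X._≈_ embed
    edges     : ∀ {i j} → i Γ.~ j → embed i X.~ embed j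

------------------------------------------------------------------------
-- Cutsize and separation profile.  A minimum or maximum of a set of
-- naturals need not be computable, so both are given by their defining
-- properties; these determine the number uniquely.

IsMinimum : (ℕ → Set p) → ℕ → Set p
IsMinimum P m = P m × (∀ k → P k → m ≤ k)

IsMaximum : (ℕ → Set p) → ℕ → Set p
IsMaximum P m = P m × (∀ k → P k → k ≤ m)

module _ (Γ : FiniteGraph) where
  open FiniteGraph Γ

  EdgeAvoiding : Subset order → Rel (Fin order) 0ℓ
  EdgeAvoiding S i j = i ∉ S × j ∉ S × i ~ j

  -- C is a connected component of Γ − S.
  IsComponent : Subset order → Subset order → Set
  IsComponent S C =
    ∃ λ i → i ∉ S × (∀ j → j ∈ C ⇔ Star (EdgeAvoiding S) i j)

  IsCutset : Subset order → Set
  IsCutset S = ∀ C → IsComponent S C → 2 * ∣ C ∣ ≤ order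

  IsCutsize : ℕ → Set
  IsCutsize = IsMinimum (λ k → ∃ λ S → IsCutset S × ∣ S ∣ ≡ k)

CutsizeOfSubgraph : Graph v ℓ e → ℕ → ℕ → Set (lsuc 0ℓ ⊔ v ⊔ ℓ ⊔ e)
CutsizeOfSubgraph X r k =
  Σ FiniteGraph λ Γ → Γ ≤ᴳ X × FiniteGraph.order Γ ≤ r × IsCutsize Γ k

IsSeparationProfile : Graph v ℓ e → (ℕ → ℕ) → Set (lsuc 0ℓ ⊔ v ⊔ ℓ ⊔ e)
IsSeparationProfile X f = ∀ r → IsMaximum (CutsizeOfSubgraph X r) (f r)

infix 4 _≲_ _≃_

_≲_ : Rel (ℕ → ℕ) 0ℓ
f ≲ g = ∃ λ C → ∀ r → f r ≤ C * g (C * r) + C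

_≃_ : Rel (ℕ → ℕ) 0ℓ
f ≃ g = f ≲ g × g ≲ f

------------------------------------------------------------------------
-- Finite generating sets and Cayley graphs

module _ (G : Group c ℓ) where
  open Group G

  -- The subgroup generated by a family of elements.
  data Generated {I : Set} (s : I → Carrier) : Carrier → Set (c ⊔ ℓ) where
    gen  : ∀ i → Generated s (s i)
    unit : Generated s ε
    mul  : ∀ {x y} → Generated s x → Generated s y → Generated s (x ∙ y)
    inv  : ∀ {x} → Generated s x → Generated s (x ⁻¹)
    resp : ∀ {x y} → x ≈ y → Generated s x → Generated s y

  record FiniteGeneratingSet : Set (c ⊔ ℓ) where
    field
      size      : ℕ
      element   : Fin size → Carrier
      generates : ∀ x → Generated element x

  module _ (S : FiniteGeneratingSet) where
    open FiniteGeneratingSet S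

    -- Loops, which the identity could contribute as a generator, are
    -- discarded.
    CayleyEdge : Rel Carrier ℓ
    CayleyEdge x y =
      ¬ x ≈ y × ∃ λ i → (y ≈ x ∙ element i) ⊎ (x ≈ y ∙ element i)

    Cayley : Graph c ℓ ℓ
    Cayley = record
      { vertices = setoid
      ; _~_      = CayleyEdge
      ; ~-resp   = respʳ , respˡ
      ; ~-sym    = flip
      ; ~-irrefl = λ x≈y (x≉y , _) → x≉y x≈y
      }
      where
      flip : Symmetric CayleyEdge
      flip (x≉y , i , p) = x≉y ∘ sym , i , swap p

      respʳ : ∀ {x y z} → y ≈ z → CayleyEdge x y → CayleyEdge x z
      respʳ y≈z (x≉y , i , inj₁ p) =
        (λ x≈z → x≉y (trans x≈z (sym y≈z))) , i , inj₁ (trans (sym y≈z) p)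
      respʳ y≈z (x≉y , i , inj₂ p) =
        (λ x≈z → x≉y (trans x≈z (sym y≈z))) , i , inj₂ (trans p (∙-congʳ y≈z))

      respˡ : ∀ {x y z} → y ≈ z → CayleyEdge y x → CayleyEdge z x
      respˡ y≈z = flip ∘ respʳ y≈z ∘ flip

------------------------------------------------------------------------
-- The free product: words in the disjoint union of G and H, modulo the
-- congruence identifying concatenation with multiplication inside each
-- factor.

module FreeProduct (G : Group c₁ ℓ₁) (H : Group c₂ ℓ₂) where
  private
    module G = Group G
    module H = Group H

  Letter : Set (c₁ ⊔ c₂)
  Letter = G.Carrier ⊎ H.Carrier

  Word : Set (c₁ ⊔ c₂)
  Word = List Letter

  infix 4 _≋_

  data _≋_ : Rel Word (c₁ ⊔ c₂ ⊔ ℓ₁ ⊔ ℓ₂) where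
    refl   : ∀ {u} → u ≋ u
    sym    : ∀ {u v} → u ≋ v → v ≋ u
    trans  : ∀ {u v w} → u ≋ v → v ≋ w → u ≋ w
    cong   : ∀ {u u′ v v′} → u ≋ u′ → v ≋ v′ → u ++ v ≋ u′ ++ v′
    ≈-G    : ∀ {x y} → x G.≈ y → [ inj₁ x ] ≋ [ inj₁ y ]
    ≈-H    : ∀ {x y} → x H.≈ y → [ inj₂ x ] ≋ [ inj₂ y ]
    ε-G    : [ inj₁ G.ε ] ≋ []
    ε-H    : [ inj₂ H.ε ] ≋ []
    ∙-G    : ∀ x y → inj₁ x ∷ inj₁ y ∷ [] ≋ [ inj₁ (x G.∙ y) ]
    ∙-H    : ∀ x y → inj₂ x ∷ inj₂ y ∷ [] ≋ [ inj₂ (x H.∙ y) ]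

  invLetter : Letter → Letter
  invLetter (inj₁ x) = inj₁ (x G.⁻¹)
  invLetter (inj₂ x) = inj₂ (x H.⁻¹)

  invWord : Word → Word
  invWord []      = []
  invWord (x ∷ w) = invWord w ++ [ invLetter x ]

  private
    reflexive : ∀ {u v} → u ≡ v → u ≋ v
    reflexive ≡.refl = refl

    invLetterˡ : ∀ x → invLetter x ∷ x ∷ [] ≋ []
    invLetterˡ (inj₁ x) = trans (∙-G _ _) (trans (≈-G (G.inverseˡ x)) ε-G)
    invLetterˡ (inj₂ x) = trans (∙-H _ _) (trans (≈-H (H.inverseˡ x)) ε-H)

    invLetterʳ : ∀ x → x ∷ invLetter x ∷ [] ≋ []
    invLetterʳ (inj₁ x) = trans (∙-G _ _) (trans (≈-G (G.inverseʳ x)) ε-G)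
    invLetterʳ (inj₂ x) = trans (∙-H _ _) (trans (≈-H (H.inverseʳ x)) ε-H)

    inverseˡ : ∀ w → invWord w ++ w ≋ []
    inverseˡ []      = refl
    inverseˡ (x ∷ w) =
      trans (reflexive (++-assoc (invWord w) [ invLetter x ] (x ∷ w)))
      (trans (cong (refl {invWord w}) (cong (invLetterˡ x) (refl {w})))
             (inverseˡ w))

    inverseʳ : ∀ w → w ++ invWord w ≋ []
    inverseʳ []      = refl
    inverseʳ (x ∷ w) =
      trans (reflexive (≡.cong (x ∷_) (≡.sym (++-assoc w (invWord w) _))))
      (trans (cong (refl {[ x ]}) (cong (inverseʳ w) (refl {[ invLetter x ]})))
             (invLetterʳ x))

    -- Inverses in a monoid are unique.
    invWord-cong : ∀ {u v} → u ≋ v → invWord u ≋ invWord v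
    invWord-cong {u} {v} u≋v =
      trans (reflexive (≡.sym (++-identityʳ (invWord u))))
      (trans (cong (refl {invWord u}) (sym (inverseʳ v)))
      (trans (reflexive (≡.sym (++-assoc (invWord u) v (invWord v))))
             (cong (trans (cong (refl {invWord u}) (sym u≋v)) (inverseˡ u))
                   (refl {invWord v}))))

  group : Group (c₁ ⊔ c₂) (c₁ ⊔ c₂ ⊔ ℓ₁ ⊔ ℓ₂)
  group = record
    { Carrier = Word
    ; _≈_     = _≋_
    ; _∙_     = _++_
    ; ε       = []
    ; _⁻¹     = invWord
    ; isGroup = record
      { isMonoid = record
        { isSemigroup = record
          { isMagma = record
            { isEquivalence = record { refl = refl ; sym = sym ; trans = trans }
            ; ∙-cong        = cong
            }
          ; assoc = λ u v w → reflexive (++-assoc u v w)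
          }
        ; identity = (λ _ → refl) , (λ u → reflexive (++-identityʳ u))
        }
      ; inverse = inverseˡ , inverseʳ
      ; ⁻¹-cong = invWord-cong
      }
    }

infixr 7 _✶_

_✶_ : Group c₁ ℓ₁ → Group c₂ ℓ₂ → Group (c₁ ⊔ c₂) (c₁ ⊔ c₂ ⊔ ℓ₁ ⊔ ℓ₂)
G ✶ H = FreeProduct.group G H

------------------------------------------------------------------------
-- Classically every graph has a separation profile, so assuming that a
-- function is the profile of a graph is no restriction on the graph.

private
  maximum-exists : ExcludedMiddle p → (P : ℕ → Set p) → P 0 →
                   ∀ b → (∀ k → P k → k ≤ b) → ∃ (IsMaximum P)
  maximum-exists em P P0 zero    bound = 0 , P0 , bound
  maximum-exists em P P0 (suc b) bound with em {P (suc b)}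
  ... | yes Pb = suc b , Pb , bound
  ... | no ¬Pb = maximum-exists em P P0 b bound′
    where
    bound′ : ∀ k → P k → k ≤ b
    bound′ k Pk with m≤n⇒m<n∨m≡n (bound k Pk)
    ... | inj₁ k<1+b  = ≤-pred k<1+b
    ... | inj₂ ≡.refl = ⊥-elim (¬Pb Pk)

  cutsize≤order : ∀ Γ {k} → IsCutsize Γ k → k ≤ FiniteGraph.order Γ
  cutsize≤order Γ (_ , minimal) =
    minimal _ (⊤ , (λ { _ (_ , i∉⊤ , _) → ⊥-elim (i∉⊤ ∈⊤) }) , ∣⊤∣≡n _)

  empty : FiniteGraph
  empty = record
    { order = 0 ; _~_ = λ () ; ~-dec = λ ()
    ; ~-sym = λ { {()} } ; ~-irrefl = λ { {()} } }

  empty-cutsize : IsCutsize empty 0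
  empty-cutsize = (Vec.[] , (λ { _ (() , _) }) , ≡.refl) , λ _ _ → z≤n

separationProfile-exists :
  ExcludedMiddle (lsuc 0ℓ ⊔ v ⊔ ℓ ⊔ e) → (X : Graph v ℓ e) →
  ∃ (IsSeparationProfile X)
separationProfile-exists em X = proj₁ ∘ profile , proj₂ ∘ profile
  where
  profile : ∀ r → ∃ (IsMaximum (CutsizeOfSubgraph X r))
  profile r = maximum-exists em (CutsizeOfSubgraph X r)
    (empty , record { embed = λ () ; injective = λ { {()} } ; edges = λ { {()} } }
           , z≤n , empty-cutsize)
    r
    (λ { _ (Γ , _ , order≤r , cut) → ≤-trans (cutsize≤order Γ cut) order≤r })

{-# OPTIONS --safe #-}

-- Call a, the maximal cutsize of the subgraphs of a finite graph, its separation
-- number.  Key fact: for every weight function on the vertices, 9a vertices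
-- suffice to cut the graph into pieces of at most half the total weight.
-- Otherwise every set of 9a vertices leaves a heavy piece; minimise
-- |Q| + μ|∂Q| over heavy sets Q with |∂Q| ≤ 9a.  As μ varies, |∂Q| cannot jump
-- over the range between 4a and 8a.  When it lies there, one finds outside Q a
-- set Y with |Y| ≥ μ|∂Q| that is fed by a flow of capacity μ from ∂Q, and Q ∪ Y
-- has no balanced cutset of size a.
--
-- Weights make both halves of the comparison easy.  A finite graph in one
-- generating set is simulated in another one by adding paths of weight 0, which
-- handles changes of generators and the inclusions of G and H into G ∗ H.  A
-- finite set in G ∗ H that is not contained in one coset of a factor has a cut
-- vertex; moving the weight of the lighter side to that vertex reduces the
-- problem, step by step, to one coset, that is, to G or H.
--
-- Everything except the constants is proved under a double negation, which is
-- harmless because inequalities between natural numbers are decidable.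

module Submission where

open import Defs
open import Algebra.Bundles using (Group)
open import Data.Nat.Base
open import Algebra.Morphism.Structures using (module GroupMorphisms; module MagmaMorphisms; module MonoidMorphisms)
import Algebra.Morphism.Construct.Identity as Identity
import Algebra.Properties.Group as GroupProperties
open import Data.Bool.Base using (Bool; true; false; T; not; _∧_; _∨_; if_then_else_)
import Data.Bool.Properties as Bool
open import Data.Bool.Properties using (∧-conicalˡ; ∧-conicalʳ; ∧-zeroʳ; ∨-zeroʳ)
open import Data.Empty using (⊥; ⊥-elim)
open import Data.Fin.Base using (Fin; zero; suc; toℕ; fromℕ<; combine; remQuot)
import Data.Fin.Properties as Fin
open import Data.Fin.Subset using (Subset; ∣_∣; _∈_; _∉_; ⊤)
open import Data.Fin.Subset.Properties using (∈⊤)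
open import Data.List.Base as List using (List; []; _∷_; [_]; _++_; _∷ʳ_)
open import Data.List.Properties using (++-assoc; ++-identityʳ)
open import Data.List.Relation.Binary.Pointwise.Base using (Pointwise; []; _∷_)
import Data.List.Relation.Binary.Pointwise as Pointwise
open import Data.Nat.Properties
open import Data.Nat.Tactic.RingSolver using (solve-∀)
open import Data.Product.Base using (∃; _×_; _,_; proj₁; proj₂)
open import Data.Sum.Base using (_⊎_; inj₁; inj₂; swap)
open import Data.Vec.Base using (lookup; tabulate; []; _∷_)
open import Data.Vec.Properties using ([]=⇒lookup; lookup⇒[]=; lookup∘tabulate)
open import Function.Base using (_∘_; id; const)
open import Function.Bundles using (_⇔_; mk⇔; module Equivalence)
open import Function.Definitions using (Injective)
open import Level using (Level) renaming (_⊔_ to _⊔ˡ_)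
open import Relation.Binary.Bundles using (Setoid)
open import Relation.Binary.Construct.Closure.ReflexiveTransitive
  using (Star; _◅_; _◅◅_; reverse; gmap) renaming (ε to done)
open import Relation.Binary.PropositionalEquality as ≡
  using (_≡_; _≢_; cong; cong₂; subst; subst₂; module ≡-Reasoning)
open import Relation.Nullary
open import Relation.Nullary.Decidable using (True; toWitness; fromWitness; ¬¬-excluded-middle; decidable-stable)
open import Algebra.Properties.Semiring.Sum +-*-semiring
  using (sum; ∑-distrib-+; ∑-comm; *-distribˡ-sum; *-distribʳ-sum; sum-cong-≗)

-- A cutset is judged by half the order of its own graph, and this is not inherited by parts: once a
-- piece has been set aside, the remainder must still be divided with respect to the old total.
-- Weights remember the missing piece, which is why the bound for counting measure has to be
-- upgraded to all weights, at the price of a factor 9. The constants arise as follows. Minimality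
-- of Q and the flow into Y give two inequalities in whose sum the lost part of ∂Q cancels; what
-- remains is |∂Q| ≤ 4a. The factor two between 4a and 8a absorbs the lowering of μ by one, given
-- that |Q| ≤ 2μa. Finally 9a = 8a + a leaves room for one more separator of size a. Once μ exceeds
-- the number of vertices, any nonempty boundary costs more than the whole graph, which has none;
-- this is the final contradiction. The flow is represented by its dual, a condition on cuts,
-- because tight cuts can be intersected by submodularity. Since equality in a group need not be
-- decidable, reducing a word in the free product is a relation and not a function.

private
  variable
    a b p q v ℓ e c₁ c₂ c₃ ℓ₁ ℓ₂ ℓ₃ : Level
    A B : Set a
    m n : ℕ


-- Double negation and extremal choices

infixl 1 _>>=_

_>>=_ : ¬ ¬ A → (A → ¬ ¬ B) → ¬ ¬ B
(x >>= f) k = x λ a → f a k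

return : A → ¬ ¬ A
return a k = k a

em : (A : Set a) → ¬ ¬ Dec A
em A = ¬¬-excluded-middle

¬¬-∀ : {P : Fin n → Set p} → (∀ i → ¬ ¬ P i) → ¬ ¬ (∀ i → P i)
¬¬-∀ {n = zero}  h = return λ ()
¬¬-∀ {n = suc n} h = do
  h₀ ← h zero
  hₛ ← ¬¬-∀ (h ∘ suc)
  return λ { zero → h₀ ; (suc i) → hₛ i }

¬¬-minimum : (P : A → Set p) (f : A → ℕ) → ∃ P →
             ¬ ¬ (∃ λ x → P x × ∀ y → P y → f x ≤ f y)
¬¬-minimum {A = A} P f (x₀ , Px₀) = go (f x₀) x₀ Px₀ ≤-refl
  where
  go : ∀ b x → P x → f x ≤ b → ¬ ¬ (∃ λ x → P x × ∀ y → P y → f x ≤ f y)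
  go zero    x Px fx≤b k = k (x , Px , λ _ _ → ≤-trans fx≤b z≤n)
  go (suc b) x Px fx≤b k = k (x , Px , λ y Py → ≮⇒≥ λ fy<fx →
    go b y Py (s≤s⁻¹ (≤-trans fy<fx fx≤b)) k)

¬¬-maximum : (P : A → Set p) (f : A → ℕ) (b : ℕ) → (∀ x → P x → f x ≤ b) → ∃ P →
             ¬ ¬ (∃ λ x → P x × ∀ y → P y → f y ≤ f x)
¬¬-maximum P f b bound inh = do
  x , Px , minimal ← ¬¬-minimum P (λ x → b ∸ f x) inh
  return (x , Px , λ y Py → ≮⇒≥ λ fx<fy →
    <⇒≱ (∸-monoʳ-< fx<fy (bound y Py)) (minimal y Py))

-- Linear arithmetic: the hypotheses are added with suitable multiples to give `l ≤ r`, and the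
-- terms `c` common to both sides are cancelled; the two equations are left to the ring solver.
linear : ∀ {l r} c {x y} → l ≤ r → l ≡ c + x → r ≡ c + y → x ≤ y
linear c {x} {y} l≤r l≡ r≡ = +-cancelˡ-≤ c x y (subst₂ _≤_ l≡ r≡ l≤r)

-- Sums over finite sets, which are given by characteristic functions

⟦_⟧ : Bool → ℕ
⟦ b ⟧ = if b then 1 else 0

Sets : ℕ → Set
Sets n = Fin n → Bool

full : Sets n
full _ = true

wt : (Fin n → ℕ) → Sets n → ℕ
wt w Z = sum λ i → ⟦ Z i ⟧ * w i

card : Sets n → ℕ
card = wt (λ _ → 1)

sum-mono : {f g : Fin n → ℕ} → (∀ i → f i ≤ g i) → sum f ≤ sum g
sum-mono {zero}  h = z≤n
sum-mono {suc n} h = +-mono-≤ (h zero) (sum-mono (h ∘ suc))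

term≤sum : (f : Fin n → ℕ) (i : Fin n) → f i ≤ sum f
term≤sum f zero    = m≤m+n (f zero) _
term≤sum f (suc i) = ≤-trans (term≤sum (f ∘ suc) i) (m≤n+m _ (f zero))

⟦⟧-mono : ∀ {x y} → (x ≡ true → y ≡ true) → ⟦ x ⟧ ≤ ⟦ y ⟧
⟦⟧-mono {false} h = z≤n
⟦⟧-mono {true}  h rewrite h ≡.refl = ≤-refl

module _ (w : Fin n → ℕ) where

  wt-+ : (A B : Sets n) → wt w A + wt w B ≡ sum λ i → (⟦ A i ⟧ + ⟦ B i ⟧) * w i
  wt-+ A B = ≡.trans (≡.sym (∑-distrib-+ (λ i → ⟦ A i ⟧ * w i) (λ i → ⟦ B i ⟧ * w i)))
    (sum-cong-≗ λ i → ≡.sym (*-distribʳ-+ (w i) ⟦ A i ⟧ ⟦ B i ⟧))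

  wt-mono : (A B : Sets n) → (∀ i → A i ≡ true → B i ≡ true) → wt w A ≤ wt w B
  wt-mono A B h = sum-mono λ i → *-monoˡ-≤ (w i) (⟦⟧-mono (h i))

  wt-≤-+ : (Z A B : Sets n) → (∀ i → ⟦ Z i ⟧ ≤ ⟦ A i ⟧ + ⟦ B i ⟧) →
           wt w Z ≤ wt w A + wt w B
  wt-≤-+ Z A B h = ≤-trans (sum-mono λ i → *-monoˡ-≤ (w i) (h i)) (≤-reflexive (≡.sym (wt-+ A B)))

  wt-+-≤ : (A B Z : Sets n) → (∀ i → ⟦ A i ⟧ + ⟦ B i ⟧ ≤ ⟦ Z i ⟧) →
           wt w A + wt w B ≤ wt w Z
  wt-+-≤ A B Z h = ≤-trans (≤-reflexive (wt-+ A B)) (sum-mono λ i → *-monoˡ-≤ (w i) (h i))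

  wt-+-≤-+ : (A B C D : Sets n) → (∀ i → ⟦ A i ⟧ + ⟦ B i ⟧ ≤ ⟦ C i ⟧ + ⟦ D i ⟧) →
             wt w A + wt w B ≤ wt w C + wt w D
  wt-+-≤-+ A B C D h = ≤-trans (≤-reflexive (wt-+ A B))
    (≤-trans (sum-mono λ i → *-monoˡ-≤ (w i) (h i)) (≤-reflexive (≡.sym (wt-+ C D))))

wt-∅ : (w : Fin n → ℕ) → wt w (λ _ → false) ≡ 0
wt-∅ {zero}  w = ≡.refl
wt-∅ {suc n} w = wt-∅ (w ∘ suc)

card-full : ∀ n → card {n} full ≡ n
card-full zero    = ≡.refl
card-full (suc n) = cong suc (card-full n)

card≤n : (Z : Sets n) → card Z ≤ n
card≤n {n} Z = ≤-trans (wt-mono {n} (const 1) Z full (λ _ _ → ≡.refl)) (≤-reflexive (card-full n))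

card-strict : (A B : Sets n) → (∀ i → A i ≡ true → B i ≡ true) →
              ∀ v → A v ≡ false → B v ≡ true → card A < card B
card-strict {suc n} A B A⊆B zero A0 B0 rewrite A0 | B0 = s≤s (wt-mono (const 1) (A ∘ suc) (B ∘ suc) (A⊆B ∘ suc))
card-strict {suc n} A B A⊆B (suc v) Av Bv =
  +-mono-≤-< (*-monoˡ-≤ 1 (⟦⟧-mono (A⊆B zero))) (card-strict (A ∘ suc) (B ∘ suc) (A⊆B ∘ suc) v Av Bv)

∀? : {P : Bool → Set} → (∀ b → Dec (P b)) → Dec (∀ b → P b)
∀? d with d true | d false
... | yes t | yes f = yes λ { true → t ; false → f }
... | no ¬t | _     = no λ h → ¬t (h true)
... | yes _ | no ¬f = no λ h → ¬f (h false)

-- Pointwise inequalities between indicators are checked by evaluating all Boolean cases: the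
-- implicit argument is filled in as soon as the decision reduces to `yes`.
bool₂ : (f g : Bool → Bool → ℕ) {_ : True (∀? λ x → ∀? λ y → f x y ≤? g x y)} →
        ∀ x y → f x y ≤ g x y
bool₂ f g {h} = toWitness h

bool₃ : (f g : Bool → Bool → Bool → ℕ)
        {_ : True (∀? λ x → ∀? λ y → ∀? λ z → f x y z ≤? g x y z)} →
        ∀ x y z → f x y z ≤ g x y z
bool₃ f g {h} = toWitness h

bool₄ : (f g : Bool → Bool → Bool → Bool → ℕ)
        {_ : True (∀? λ x → ∀? λ y → ∀? λ z → ∀? λ t → f x y z t ≤? g x y z t)} →
        ∀ x y z t → f x y z t ≤ g x y z t
bool₄ f g {h} = toWitness h

true? : ∀ b → b ≡ true ⊎ b ≡ false
true? true  = inj₁ ≡.refl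
true? false = inj₂ ≡.refl

true≢false : ∀ {b} → b ≡ true → b ≡ false → ⊥
true≢false ≡.refl ()

∧-true : ∀ {x y} → x ≡ true → y ≡ true → x ∧ y ≡ true
∧-true ≡.refl ≡.refl = ≡.refl

∨-trueˡ : ∀ {x y} → x ≡ true → x ∨ y ≡ true
∨-trueˡ ≡.refl = ≡.refl

∨-trueʳ : ∀ x {y} → y ≡ true → x ∨ y ≡ true
∨-trueʳ x ≡.refl = ∨-zeroʳ x

∨-elim : ∀ {x y} → x ∨ y ≡ true → x ≡ true ⊎ y ≡ true
∨-elim {true}  _ = inj₁ ≡.refl
∨-elim {false} h = inj₂ h

∨-false : ∀ {x y} → x ∨ y ≡ false → x ≡ false × y ≡ false
∨-false {false} h = ≡.refl , h

not-true : ∀ {x} → x ≡ false → not x ≡ true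
not-true ≡.refl = ≡.refl

not-true⁻¹ : ∀ {x} → not x ≡ true → x ≡ false
not-true⁻¹ {false} _ = ≡.refl

-- Balanced separators

cls : Sets n → Sets n → (Fin n → ℕ) → ℕ → Sets n
cls Y S c k i = Y i ∧ not (S i) ∧ (c i ≡ᵇ k)

cls-true : (Y S : Sets n) (c : Fin n → ℕ) {k : ℕ} {i : Fin n} →
           Y i ≡ true → S i ≡ false → c i ≡ k → cls Y S c k i ≡ true
cls-true Y S c {i = i} Yi Si ≡.refl rewrite Yi | Si = ≡ᵇ-refl (c i)
  where
  ≡ᵇ-refl : ∀ x → (x ≡ᵇ x) ≡ true
  ≡ᵇ-refl zero    = ≡.refl
  ≡ᵇ-refl (suc x) = ≡ᵇ-refl x

cls-elim : (Y S : Sets n) (c : Fin n → ℕ) {k : ℕ} {i : Fin n} →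
           cls Y S c k i ≡ true → Y i ≡ true × S i ≡ false × c i ≡ k
cls-elim Y S c {k} {i} h with Y i | S i
... | true | false = ≡.refl , ≡.refl , ≡ᵇ⇒≡ (c i) k (subst T (≡.sym h) _)

-- S separates the weighted graph induced on Y into pieces of at most half the
-- weight; the pieces, the level sets of c, are unions of components.
Sep : (Fin n → Fin n → Set p) → Sets n → (Fin n → ℕ) → ℕ → Set p
Sep {n} E Y w b = ∃ λ (S : Sets n) → ∃ λ (c : Fin n → ℕ) → card S ≤ b ×
  (∀ {i j} → E i j → Y i ≡ true → Y j ≡ true → S i ≡ false → S j ≡ false → c i ≡ c j) ×
  (∀ k → 2 * wt w (cls Y S c k) ≤ wt w Y)

-- From counting measure to arbitrary weights

module WeightedSeparator {n : ℕ} (E : Fin n → Fin n → Set p)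
  (E-sym : ∀ {i j} → E i j → E j i) (a : ℕ)
  (separate : ∀ Y → ¬ ¬ Sep E Y (λ _ → 1) a)
  (w : Fin n → ℕ) (noSep : ¬ Sep E full w (9 * a)) where

  Heavy : Sets n → Set
  Heavy Q = wt w full < 2 * wt w Q

  -- `W` has to contain the boundary of `Q` but may be larger, so that boundaries can be
  -- overestimated when a region is modified.
  record Region (Q W : Sets n) : Set p where
    field
      heavy    : Heavy Q
      small    : card W ≤ 9 * a
      disjoint : ∀ {i} → Q i ≡ true → W i ≡ false
      closed   : ∀ {i j} → E i j → Q i ≡ true → Q j ∨ W j ≡ true
  open Region

  φ : ℕ → Sets n → Sets n → ℕ
  φ μ Q W = card Q + μ * card W

  Minimal : ℕ → Sets n → Sets n → Set p
  Minimal μ Q W = ∀ Q′ W′ → Region Q′ W′ → φ μ Q W ≤ φ μ Q′ W′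

  complement-light : ∀ {Q} (Z : Sets n) → Heavy Q → (∀ i → ⟦ Z i ⟧ + ⟦ Q i ⟧ ≤ 1) →
                     2 * wt w Z ≤ wt w full
  complement-light {Q} Z hQ h = linear (2 * wt w Q) sum≤ refl-l ≡.refl
    where
    s : wt w Z + wt w Q ≤ wt w full
    s = wt-+-≤ w Z Q full h
    sum≤ : 2 * (wt w Z + wt w Q) ≤ 2 * wt w Q + wt w full
    sum≤ = begin
      2 * (wt w Z + wt w Q)        ≤⟨ *-monoʳ-≤ 2 s ⟩
      2 * wt w full                ≡⟨ lem (wt w full) ⟩
      wt w full + wt w full        ≤⟨ +-monoˡ-≤ (wt w full) (<⇒≤ hQ) ⟩
      2 * wt w Q + wt w full       ∎
      where
      open ≤-Reasoning
      lem : ∀ x → 2 * x ≡ x + x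
      lem = solve-∀
    refl-l : 2 * (wt w Z + wt w Q) ≡ 2 * wt w Q + 2 * wt w Z
    refl-l = lem (wt w Z) (wt w Q)
      where
      lem : ∀ x y → 2 * (x + y) ≡ 2 * y + 2 * x
      lem = solve-∀

  -- If all classes were light, `W` and `S` together would contradict `noSep`: `W` cuts `Q` off, and
  -- the complement of the heavy set `Q` is light.
  heavy-class : ∀ {Q W} → Region Q W → (S : Sets n) (c : Fin n → ℕ) →
    (∀ {i j} → E i j → Q i ≡ true → Q j ≡ true → S i ≡ false → S j ≡ false → c i ≡ c j) →
    card W + card S ≤ 9 * a → ¬ ¬ ∃ λ k → Heavy (cls Q S c k)
  heavy-class {Q} {W} R S c consistent small′ ¬heavy = noSep (S′ , c′ , S′-small , consistent′ , light)
    where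
    S′ : Sets n
    S′ i = W i ∨ S i
    c′ : Fin n → ℕ
    -- The label 0 is reserved for the complement of `Q`.
    c′ i = if Q i then suc (c i) else 0
    S′-small : card S′ ≤ 9 * a
    S′-small = ≤-trans (wt-≤-+ (const 1) S′ W S λ i →
      bool₂ (λ x y → ⟦ x ∨ y ⟧) (λ x y → ⟦ x ⟧ + ⟦ y ⟧) (W i) (S i)) small′
    consistent′ : ∀ {i j} → E i j → true ≡ true → true ≡ true →
                  S′ i ≡ false → S′ j ≡ false → c′ i ≡ c′ j
    consistent′ {i} {j} Eij _ _ Si Sj with Q i in Qi | Q j in Qj
    ... | true  | true  = cong suc (consistent Eij Qi Qj (proj₂ (∨-false {W i} Si)) (proj₂ (∨-false {W j} Sj)))
    ... | false | false = ≡.refl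
    ... | true  | false with ∨-elim {Q j} (closed R Eij Qi)
    ...   | inj₁ Qj′ = ⊥-elim (true≢false Qj′ Qj)
    ...   | inj₂ Wj  = ⊥-elim (true≢false Wj (proj₁ (∨-false {W j} Sj)))
    consistent′ {i} {j} Eij _ _ Si Sj | false | true with ∨-elim {Q i} (closed R (E-sym Eij) Qj)
    ...   | inj₁ Qi′ = ⊥-elim (true≢false Qi′ Qi)
    ...   | inj₂ Wi  = ⊥-elim (true≢false Wi (proj₁ (∨-false {W i} Si)))
    light : ∀ k → 2 * wt w (cls full S′ c′ k) ≤ wt w full
    light zero = complement-light (cls full S′ c′ 0) (heavy R) pointwise
      where
      pointwise : ∀ i → ⟦ cls full S′ c′ 0 i ⟧ + ⟦ Q i ⟧ ≤ 1
      pointwise i with Q i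
      ... | false = ≤-trans (≤-reflexive (+-identityʳ _)) (⟦⟧-mono {y = true} λ _ → ≡.refl)
      ... | true with S′ i
      ...   | true  = ≤-refl
      ...   | false = ≤-refl
    light (suc k) = ≤-trans (*-monoʳ-≤ 2 (wt-mono w (cls full S′ c′ (suc k)) (cls Q S c k) sub)) (≮⇒≥ λ h → ¬heavy (k , h))
      where
      sub : ∀ i → cls full S′ c′ (suc k) i ≡ true → cls Q S c k i ≡ true
      sub i h = from-label (true? (Q i)) (cls-elim full S′ c′ {suc k} {i} h)
        where
        from-label : Q i ≡ true ⊎ Q i ≡ false →
                     true ≡ true × S′ i ≡ false × c′ i ≡ suc k → cls Q S c k i ≡ true
        from-label (inj₁ Qi) (_ , S′i , c′i) = cls-true Q S c Qi (proj₂ (∨-false {W i} S′i))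
          (suc-injective (subst (λ b → (if b then suc (c i) else 0) ≡ suc k) Qi c′i))
        from-label (inj₂ Qi) (_ , S′i , c′i) =
          ⊥-elim (0≢1+n (subst (λ b → (if b then suc (c i) else 0) ≡ suc k) Qi c′i))

  -- A separator of `Q` for counting measure leaves a class that is heavy for `w` and yet has at
  -- most half the vertices; the boundary gains at most this separator.
  halve : ∀ {Q W} → Region Q W → card W + a ≤ 9 * a →
    ¬ ¬ ∃ λ Q′ → ∃ λ W′ → Region Q′ W′ × 2 * card Q′ ≤ card Q × card W′ ≤ card W + a
  halve {Q} {W} R room = do
    S , c , S≤a , consistent , light ← separate Q
    let room′ = ≤-trans (+-monoʳ-≤ (card W) S≤a) room
        W∪S≤ = wt-≤-+ (const 1) (λ i → W i ∨ S i) W S λ i →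
          bool₂ (λ x y → ⟦ x ∨ y ⟧) (λ x y → ⟦ x ⟧ + ⟦ y ⟧) (W i) (S i)
    k , hv ← heavy-class R S c consistent room′
    return (cls Q S c k , (λ i → W i ∨ S i)
           , record { heavy = hv ; small = ≤-trans W∪S≤ room′
                    ; disjoint = disjoint′ S c k ; closed = closed′ S c k consistent }
           , light k , ≤-trans W∪S≤ (+-monoʳ-≤ (card W) S≤a))
    where
    disjoint′ : ∀ S c k {i} → cls Q S c k i ≡ true → W i ∨ S i ≡ false
    disjoint′ S c k {i} Q′i = let Qi , Si , _ = cls-elim Q S c {k} {i} Q′i in
      cong₂ _∨_ (disjoint R Qi) Si
    closed′ : ∀ S c k →
      (∀ {i j} → E i j → Q i ≡ true → Q j ≡ true → S i ≡ false → S j ≡ false → c i ≡ c j) →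
      ∀ {i j} → E i j → cls Q S c k i ≡ true → cls Q S c k j ∨ (W j ∨ S j) ≡ true
    closed′ S c k consistent {i} {j} Eij Q′i
      with cls-elim Q S c {k} {i} Q′i
    ... | Qi , Si , ci with true? (S j)
    ...   | inj₁ Sj = ∨-trueʳ (cls Q S c k j) (∨-trueʳ (W j) Sj)
    ...   | inj₂ Sj with ∨-elim {Q j} (closed R Eij Qi)
    ...     | inj₁ Qj = ∨-trueˡ
                (cls-true Q S c Qj Sj (≡.trans (≡.sym (consistent Eij Qi Qj Si Sj)) ci))
    ...     | inj₂ Wj = ∨-trueʳ (cls Q S c k j) (∨-trueˡ Wj)

  -- M separates W from Y ∖ Z inside Y, where Z is the part that W still reaches.
  record Cut (Y W Z M : Sets n) : Set p where
    field
      inside : ∀ i → Z i ≡ true → Y i ≡ true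
      source : ∀ i → W i ≡ true → Z i ≡ false → M i ≡ true
      border : ∀ {i j} → E i j → Z i ≡ true → Y j ≡ true → Z j ∨ M j ≡ true
  open Cut

  -- By max-flow min-cut this says that a flow from W through Y with vertex
  -- capacities μ can deliver one unit to every vertex of Y.
  Fed : ℕ → Sets n → Sets n → Set p
  Fed μ W Y = ∀ Z M → Cut Y W Z M → card Y ≤ φ μ Z M

  -- Uncrossing of vertex cuts. The boundaries on the left are those for which the intersection and
  -- the union are again cuts, and each vertex occurs in them no more often than in `M` and `M′`
  -- together.
  submodular : ∀ μ (Z M Z′ M′ : Sets n) →
    φ μ (λ i → Z i ∧ Z′ i) (λ i → M i ∧ M′ i ∨ M i ∧ Z′ i ∨ Z i ∧ M′ i) +
    φ μ (λ i → Z i ∨ Z′ i) (λ i → (M i ∨ M′ i) ∧ not (Z i ∨ Z′ i)) ≤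
    φ μ Z M + φ μ Z′ M′
  submodular μ Z M Z′ M′ = begin
    (card Z∩ + μ * card M∩) + (card Z∪ + μ * card M∪) ≡⟨ regroup (card Z∩) (card M∩) (card Z∪) (card M∪) μ ⟩
    (card Z∩ + card Z∪) + μ * (card M∩ + card M∪)     ≤⟨ +-mono-≤ vertices (*-monoʳ-≤ μ boundaries) ⟩
    (card Z + card Z′) + μ * (card M + card M′)       ≡⟨ regroup (card Z) (card M) (card Z′) (card M′) μ ⟨
    (card Z + μ * card M) + (card Z′ + μ * card M′)   ∎
    where
    open ≤-Reasoning
    Z∩ = λ i → Z i ∧ Z′ i
    M∩ = λ i → M i ∧ M′ i ∨ M i ∧ Z′ i ∨ Z i ∧ M′ i
    Z∪ = λ i → Z i ∨ Z′ i
    M∪ = λ i → (M i ∨ M′ i) ∧ not (Z i ∨ Z′ i)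
    regroup : ∀ z m z′ m′ μ → (z + μ * m) + (z′ + μ * m′) ≡ (z + z′) + μ * (m + m′)
    regroup = solve-∀
    vertices : card Z∩ + card Z∪ ≤ card Z + card Z′
    vertices = wt-+-≤-+ (const 1) Z∩ Z∪ Z Z′ λ i →
      bool₂ (λ z z′ → ⟦ z ∧ z′ ⟧ + ⟦ z ∨ z′ ⟧) (λ z z′ → ⟦ z ⟧ + ⟦ z′ ⟧) (Z i) (Z′ i)
    boundaries : card M∩ + card M∪ ≤ card M + card M′
    boundaries = wt-+-≤-+ (const 1) M∩ M∪ M M′ λ i →
      bool₄ (λ z m z′ m′ → ⟦ m ∧ m′ ∨ m ∧ z′ ∨ z ∧ m′ ⟧ + ⟦ (m ∨ m′) ∧ not (z ∨ z′) ⟧)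
            (λ z m z′ m′ → ⟦ m ⟧ + ⟦ m′ ⟧) (Z i) (M i) (Z′ i) (M′ i)

  module _ {Y W Z M Z′ M′ : Sets n} (C : Cut Y W Z M) (C′ : Cut Y W Z′ M′) where

    Cut-∩ : Cut Y W (λ i → Z i ∧ Z′ i) (λ i → M i ∧ M′ i ∨ M i ∧ Z′ i ∨ Z i ∧ M′ i)
    Cut-∩ .inside i h = inside C i (∧-conicalˡ _ _ h)
    Cut-∩ .source i Wi h with Z i | Z′ i | M i | M′ i | source C i Wi | source C′ i Wi
    ... | false | false | true  | true  | _ | _ = ≡.refl
    ... | false | true  | true  | true  | _ | _ = ≡.refl
    ... | false | true  | true  | false | _ | _ = ≡.refl
    ... | true  | false | false | true  | _ | _ = ≡.refl
    ... | true  | false | true  | true  | _ | _ = ≡.refl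
    ... | false | z′    | false | m′    | s | _ = ⊥-elim (true≢false (s ≡.refl) ≡.refl)
    ... | z     | false | m     | false | _ | s = ⊥-elim (true≢false (s ≡.refl) ≡.refl)
    Cut-∩ .border {i} {j} Eij h Yj
      with Z j | M j | Z′ j | M′ j | border C Eij (∧-conicalˡ (Z i) _ h) Yj
         | border C′ Eij (∧-conicalʳ (Z i) _ h) Yj
    ... | true  | _     | true  | _     | _ | _ = ≡.refl
    ... | true  | true  | false | true  | _ | _ = ≡.refl
    ... | true  | false | false | true  | _ | _ = ≡.refl
    ... | false | true  | true  | true  | _ | _ = ≡.refl
    ... | false | true  | true  | false | _ | _ = ≡.refl
    ... | false | true  | false | true  | _ | _ = ≡.refl

    Cut-∪ : Cut Y W (λ i → Z i ∨ Z′ i) (λ i → (M i ∨ M′ i) ∧ not (Z i ∨ Z′ i))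
    Cut-∪ .inside i h with ∨-elim {Z i} h
    ... | inj₁ Zi  = inside C i Zi
    ... | inj₂ Z′i = inside C′ i Z′i
    Cut-∪ .source i Wi h = ∧-true (∨-trueˡ (source C i Wi (proj₁ (∨-false {Z i} h)))) (not-true h)
    Cut-∪ .border {i} {j} Eij h Yj with ∨-elim {Z i} h
    ... | inj₁ Zi with Z j | Z′ j | M j | border C Eij Zi Yj
    ...   | true  | _     | _    | _ = ≡.refl
    ...   | false | true  | _    | _ = ≡.refl
    ...   | false | false | true | _ = ≡.refl
    Cut-∪ .border {i} {j} Eij h Yj | inj₂ Z′i with Z j | Z′ j | M j | M′ j | border C′ Eij Z′i Yj
    ...   | true  | _     | _     | _    | _ = ≡.refl
    ...   | false | true  | _     | _    | _ = ≡.refl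
    ...   | false | false | true  | _    | _ = ≡.refl
    ...   | false | false | false | true | _ = ≡.refl

  insert : Fin n → Sets n → Sets n
  insert v Y i = does (i Fin.≟ v) ∨ Y i

  delete : Fin n → Sets n → Sets n
  delete v Y i = not (does (i Fin.≟ v)) ∧ Y i

  card-insert : ∀ v {Y} → Y v ≡ false → card Y < card (insert v Y)
  card-insert v {Y} Yv = card-strict Y (insert v Y) (λ i → ∨-trueʳ (does (i Fin.≟ v))) v Yv insert-v
    where
    insert-v : insert v Y v ≡ true
    insert-v with v Fin.≟ v
    ... | yes _ = ≡.refl
    ... | no ne = ⊥-elim (ne ≡.refl)

  delete-v : ∀ v Y → delete v Y v ≡ false
  delete-v v Y with v Fin.≟ v
  ... | yes _ = ≡.refl
  ... | no ne = ⊥-elim (ne ≡.refl)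

  delete-⊆ : ∀ v Y i → delete v Y i ≡ true → Y i ≡ true
  delete-⊆ v Y i = ∧-conicalʳ (not (does (i Fin.≟ v))) (Y i)

  delete-true : ∀ {v Y i} → i ≢ v → Y i ≡ true → delete v Y i ≡ true
  delete-true {v} {Y} {i} i≢v Yi with i Fin.≟ v
  ... | yes p = ⊥-elim (i≢v p)
  ... | no _  = Yi

  delete-false : ∀ {v Y i} → i ≢ v → delete v Y i ≡ false → Y i ≡ false
  delete-false {v} {Y} {i} i≢v h with i Fin.≟ v
  ... | yes p = ⊥-elim (i≢v p)
  ... | no _  = h

  card-delete : ∀ v Y → Y v ≡ true → card (delete v Y) < card Y
  card-delete v Y Yv = card-strict (delete v Y) Y (delete-⊆ v Y) v (delete-v v Y) Yv

  insert-elim : ∀ v Y i → insert v Y i ≡ true → i ≡ v ⊎ Y i ≡ true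
  insert-elim v Y i h with i Fin.≟ v
  ... | yes p = inj₁ p
  ... | no _  = inj₂ h

  insert-⊇ : ∀ v Y i → Y i ≡ true → insert v Y i ≡ true
  insert-⊇ v Y i = ∨-trueʳ (does (i Fin.≟ v))

  module _ {Q W : Sets n} (R : Region Q W) (μ : ℕ) (μ>0 : 0 < μ) (minimal : Minimal μ Q W) where

    private
      outside : Sets n
      outside i = not (Q i)

      W⊆outside : ∀ i → W i ≡ true → outside i ≡ true
      W⊆outside i Wi with true? (Q i)
      ... | inj₁ Qi = ⊥-elim (true≢false Wi (disjoint R Qi))
      ... | inj₂ Qi = not-true Qi

    -- A cut that is too cheap could be used to enlarge `Q`: the union of `Q` and `Z` is still heavy
    -- and its boundary lies in `M`.
    outside-cut : ∀ {Z M} → Cut outside W Z M → μ * card W ≤ φ μ Z M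
    outside-cut {Z} {M} C with card M ≤? 9 * a
    -- Here `M` is too large to bound a region, but then it is larger than `W` anyway.
    ... | no  M≰ = ≤-trans (*-monoʳ-≤ μ (≤-trans (small R) (<⇒≤ (≰⇒> M≰)))) (m≤n+m _ _)
    ... | yes M≤ = linear (card Q) (≤-trans (minimal Q′ M′ R′) φ′≤) ≡.refl (+-assoc (card Q) (card Z) _)
      where
      Q′ M′ : Sets n
      Q′ i = Q i ∨ Z i
      M′ i = M i ∧ not (Q′ i)
      M′≤M : card M′ ≤ card M
      M′≤M = wt-mono (const 1) M′ M λ i → ∧-conicalˡ (M i) _
      φ′≤ : φ μ Q′ M′ ≤ card Q + card Z + μ * card M
      φ′≤ = +-mono-≤ (wt-≤-+ (const 1) Q′ Q Z λ i →
        bool₂ (λ x y → ⟦ x ∨ y ⟧) (λ x y → ⟦ x ⟧ + ⟦ y ⟧) (Q i) (Z i)) (*-monoʳ-≤ μ M′≤M)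
      into : ∀ j → Z j ∨ M j ≡ true → Q′ j ∨ M′ j ≡ true
      into j h with Q j | Z j | M j
      ... | true  | _     | _    = ≡.refl
      ... | false | true  | _    = ≡.refl
      ... | false | false | true = ≡.refl
      R′ : Region Q′ M′
      R′ .heavy = ≤-trans (heavy R) (*-monoʳ-≤ 2 (wt-mono w Q Q′ λ i → ∨-trueˡ))
      R′ .small = ≤-trans M′≤M M≤
      R′ .disjoint {i} Q′i rewrite Q′i with M i
      ... | true  = ≡.refl
      ... | false = ≡.refl
      R′ .closed {i} {j} Eij Q′i with true? (Q j)
      ... | inj₁ Qj = ∨-trueˡ (∨-trueˡ Qj)
      ... | inj₂ Qj with ∨-elim {Q i} Q′i
      ...   | inj₂ Zi = into j (border C Eij Zi (not-true Qj))
      ...   | inj₁ Qi with ∨-elim {Q j} (closed R Eij Qi)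
      ...     | inj₁ Qj′ = ⊥-elim (true≢false Qj′ Qj)
      ...     | inj₂ Wj with true? (Z j)
      ...       | inj₁ Zj = into j (∨-trueˡ Zj)
      ...       | inj₂ Zj = into j (∨-trueʳ (Z j) (source C j Wj Zj))

    FedSet : Sets n → Set p
    FedSet Y = (∀ i → W i ≡ true → Y i ≡ true) × (∀ i → Y i ≡ true → outside i ≡ true) × Fed μ W Y

    -- As `μ` is at least 1, each vertex of `W` feeds itself; this starts the maximisation.
    Fed-W : Fed μ W W
    Fed-W Z M C = ≤-trans (wt-≤-+ (const 1) W Z M pointwise)
      (+-monoʳ-≤ (card Z) (≤-trans (≤-reflexive (≡.sym (*-identityˡ (card M)))) (*-monoˡ-≤ (card M) μ>0)))
      where
      pointwise : ∀ i → ⟦ W i ⟧ ≤ ⟦ Z i ⟧ + ⟦ M i ⟧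
      pointwise i with W i | Z i | M i | source C i
      ... | false | _     | _     | _ = z≤n
      ... | true  | true  | _     | _ = s≤s z≤n
      ... | true  | false | true  | _ = ≤-refl
      ... | true  | false | false | s = ⊥-elim (true≢false (s ≡.refl ≡.refl) ≡.refl)

    -- Take Y maximal.  If μ * card W exceeded card Y, then every vertex v that
    -- cannot be added to Y would be shielded from W by a tight cut of Y, and
    -- the smallest tight cut would shield all of them, contradicting the
    -- minimality of Q.
    exists-fed : ¬ ¬ ∃ λ Y → FedSet Y × μ * card W ≤ card Y
    exists-fed = do
      Y , (W⊆Y , Y⊆ , fed) , maximal ← ¬¬-maximum FedSet card n (λ Y _ → card≤n Y)
        (W , (λ _ Wi → Wi) , W⊆outside , Fed-W)
      λ k → k (Y , (W⊆Y , Y⊆ , fed) , ≮⇒≥ λ Y<μW →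
        maximal-large W⊆Y Y⊆ fed maximal Y<μW)
      where
      module _ {Y : Sets n} (W⊆Y : ∀ i → W i ≡ true → Y i ≡ true)
        (Y⊆ : ∀ i → Y i ≡ true → outside i ≡ true) (fed : Fed μ W Y)
        (maximal : ∀ Y′ → FedSet Y′ → card Y′ ≤ card Y)
        (Y<μW : card Y < μ * card W) where

        -- By `fed` the inequality is an equality.
        Tight : Sets n × Sets n → Set p
        Tight (Z , M) = Cut Y W Z M × φ μ Z M ≤ card Y

        tight-Y : Tight (Y , λ _ → false)
        tight-Y .proj₁ .inside _ Yi = Yi
        tight-Y .proj₁ .source i Wi Yi = ⊥-elim (true≢false (W⊆Y i Wi) Yi)
        tight-Y .proj₁ .border _ _ Yj = ∨-trueˡ Yj
        tight-Y .proj₂ = ≤-reflexive (≡.trans (cong (λ x → card Y + μ * x) (wt-∅ {n} (const 1)))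
          (≡.trans (cong (card Y +_) (*-zeroʳ μ)) (+-identityʳ _)))

        -- Since `Y` is maximal, some cut `(Z , M)` shows that `insert v Y` is not fed. It is tight
        -- for `Y`. Neither `Z` nor `M` can be made smaller by deleting `v`, as that would
        -- contradict `fed`; so `v` is not in `Z`, and a neighbour of `v` in `Z` would force `v`
        -- into `M`.
        shield : ∀ {v} → Y v ≡ false → outside v ≡ true →
          ¬ ¬ ∃ λ Z → ∃ λ M → Tight (Z , M) × (∀ {i} → E i v → Z i ≡ false)
        shield {v} Yv v∈outside k = <⇒≱ (card-insert v {Y} Yv) (maximal (insert v Y)
          ( (λ i Wi → insert-⊇ v Y i (W⊆Y i Wi)) , Y+v⊆ , fed+v))
          where
          Y+v⊆ : ∀ i → insert v Y i ≡ true → outside i ≡ true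
          Y+v⊆ i h with insert-elim v Y i h
          ... | inj₁ ≡.refl = v∈outside
          ... | inj₂ Yi   = Y⊆ i Yi
          W∌v : ∀ {i} → W i ≡ true → i ≢ v
          W∌v Wi ≡.refl = true≢false (W⊆Y _ Wi) Yv
          Y∌v : ∀ {i} → Y i ≡ true → i ≢ v
          Y∌v Yi ≡.refl = true≢false Yi Yv
          fed+v : Fed μ W (insert v Y)
          fed+v Z M C = ≮⇒≥ λ φ<Y+v → violated (s≤s⁻¹ (≤-trans φ<Y+v card-insert≤)) (true? (Z v))
            where
            card-insert≤ : card (insert v Y) ≤ suc (card Y)
            card-insert≤ = card-insert-≤ v Y
              where
              card-insert-≤ : ∀ {n} (v : Fin n) (Y : Sets n) →
                card (λ i → does (i Fin.≟ v) ∨ Y i) ≤ suc (card Y)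
              card-insert-≤ {suc n} zero Y = s≤s (≤-trans (≤-reflexive ≡.refl) (m≤n+m _ (⟦ Y zero ⟧ * 1)))
              card-insert-≤ {suc n} (suc v) Y = ≤-trans (+-monoʳ-≤ (⟦ Y zero ⟧ * 1) (card-insert-≤ v (Y ∘ suc)))
                (≤-reflexive (+-suc _ _))
            violated : φ μ Z M ≤ card Y → Z v ≡ true ⊎ Z v ≡ false → ⊥
            violated φ≤Y (inj₁ Zv) = <⇒≱ (+-monoˡ-< (μ * card M) (card-delete v Z Zv))
              (≤-trans φ≤Y (fed (delete v Z) M cut))
              where
              cut : Cut Y W (delete v Z) M
              cut .inside i h with insert-elim v Y i (inside C i (delete-⊆ v Z i h))
              ... | inj₁ ≡.refl = ⊥-elim (true≢false h (delete-v v Z))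
              ... | inj₂ Yi   = Yi
              cut .source i Wi h = source C i Wi (delete-false {v} {Z} (W∌v Wi) h)
              cut .border {i} {j} Eij h Yj
                with ∨-elim {Z j} (border C Eij (delete-⊆ v Z i h) (insert-⊇ v Y j Yj))
              ... | inj₁ Zj = ∨-trueˡ (delete-true {v} {Z} (Y∌v Yj) Zj)
              ... | inj₂ Mj = ∨-trueʳ (delete v Z j) Mj
            violated φ≤Y (inj₂ Zv) = k (Z , M , (cut , φ≤Y) , λ {i} Eiv → unreached Eiv (true? (Z i)))
              where
              Z⊆Y : ∀ i → Z i ≡ true → Y i ≡ true
              Z⊆Y i Zi with insert-elim v Y i (inside C i Zi)
              ... | inj₁ ≡.refl = ⊥-elim (true≢false Zi Zv)
              ... | inj₂ Yi   = Yi
              cut : Cut Y W Z M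
              cut .inside = Z⊆Y
              cut .source = source C
              cut .border Eij Zi Yj = border C Eij Zi (insert-⊇ v Y _ Yj)
              cut-v : Cut Y W Z (delete v M)
              cut-v .inside = Z⊆Y
              cut-v .source i Wi h = delete-true {v} {M} (W∌v Wi) (source C i Wi h)
              cut-v .border {i} {j} Eij Zi Yj with ∨-elim {Z j} (border cut Eij Zi Yj)
              ... | inj₁ Zj = ∨-trueˡ Zj
              ... | inj₂ Mj = ∨-trueʳ (Z j) (delete-true {v} {M} (Y∌v Yj) Mj)
              v∈Y+v : insert v Y v ≡ true
              v∈Y+v with v Fin.≟ v
              ... | yes _ = ≡.refl
              ... | no ne = ⊥-elim (ne ≡.refl)
              unreached : ∀ {i} → E i v → Z i ≡ true ⊎ Z i ≡ false → Z i ≡ false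
              unreached _ (inj₂ Zi) = Zi
              unreached {i} Eiv (inj₁ Zi) with ∨-elim {Z v} (border C Eiv Zi v∈Y+v)
              ... | inj₁ Zv′ = ⊥-elim (true≢false Zv′ Zv)
              ... | inj₂ Mv  = ⊥-elim (<⇒≱
                (+-monoʳ-< (card Z) (*-monoʳ-< μ ⦃ >-nonZero μ>0 ⦄ (card-delete v M Mv)))
                (≤-trans φ≤Y (fed Z (delete v M) cut-v)))

        maximal-large : ⊥
        maximal-large = ¬¬-minimum Tight (card ∘ proj₁) (_ , tight-Y)
          λ ((Z , M) , (C , tight) , least) →
          ¬¬-∀ {P = λ v → ∀ i → E i v → Z i ≡ true → outside v ≡ true → Z v ∨ M v ≡ true}
            (λ v → ¬¬-∀ λ i → shielded C tight least (true? (Y v)) (true? (Z v ∨ M v)))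
            λ bord → <⇒≱ Y<μW (≤-trans (outside-cut (record
              { inside = λ i Zi → Y⊆ i (inside C i Zi)
              ; source = source C
              ; border = λ Eij Zi → bord _ _ Eij Zi })) tight)
          where
          -- The union with the cut that shields `v` costs at least `card Y`, so by submodularity
          -- the intersection is tight. It would lose the neighbour `i` of `v` and thus be smaller
          -- than the least tight cut.
          shielded : ∀ {Z M v i} → Cut Y W Z M → φ μ Z M ≤ card Y →
            (∀ ZM → Tight ZM → card Z ≤ card (proj₁ ZM)) →
            Y v ≡ true ⊎ Y v ≡ false → Z v ∨ M v ≡ true ⊎ Z v ∨ M v ≡ false →
            ¬ ¬ (E i v → Z i ≡ true → outside v ≡ true → Z v ∨ M v ≡ true)
          shielded C tight least (inj₁ Yv) _ = return λ Eiv Zi _ → border C Eiv Zi Yv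
          shielded C tight least _ (inj₁ h) = return λ _ _ _ → h
          shielded {Z} {M} {v} {i} C tight least (inj₂ Yv) (inj₂ _) k = k λ Eiv Zi v∈outside →
            ⊥-elim (shield Yv v∈outside λ (Z′ , M′ , (C′ , tight′) , unreached) →
              let sub = ≤-trans (submodular μ Z M Z′ M′) (+-mono-≤ tight tight′)
                  ∪≥ = fed _ _ (Cut-∪ C C′)
                  ∩≤ = +-cancelʳ-≤ (card Y) _ _ (≤-trans (+-monoʳ-≤ _ ∪≥) sub)
              in <⇒≱ (card-strict (λ i → Z i ∧ Z′ i) Z (λ i → ∧-conicalˡ (Z i) _) i
                       (≡.trans (cong (Z i ∧_) (unreached Eiv)) (∧-zeroʳ (Z i))) Zi)
                     (least _ (Cut-∩ C C′ , ∩≤)))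

    -- Separate the union of `Q` and a fed set `Y`, and let `C` be the piece that keeps the heavy
    -- part of `Q`. Inside `C`, the region `Q₁` competes with `Q`, which bounds the cost of the part
    -- `W₂` of `W` outside `C`. For `Y`, the same `W₂` together with `S` is a cut around `Y₁`. A
    -- balanced `C` makes both bounds strong enough to compare `μ * card W` with `μ * (4 * a)`.
    minimal-low : card W + a ≤ 9 * a → ¬ ¬ card W ≤ 4 * a
    minimal-low room = do
      Y , (W⊆Y , Y⊆ , fed) , μW≤Y ← exists-fed
      S , c , S≤a , consistent , light ← separate (λ i → Q i ∨ Y i)
      k , hv ← heavy-class R S c
        (λ Eij Qi Qj → consistent Eij (∨-trueˡ Qi) (∨-trueˡ Qj))
        (≤-trans (+-monoʳ-≤ (card W) S≤a) room)
      return (split W⊆Y Y⊆ fed μW≤Y S c k S≤a consistent (light k) hv)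
      where
      module _ {Y : Sets n} (W⊆Y : ∀ i → W i ≡ true → Y i ≡ true)
        (Y⊆ : ∀ i → Y i ≡ true → outside i ≡ true) (fed : Fed μ W Y) (μW≤Y : μ * card W ≤ card Y)
        (S : Sets n) (c : Fin n → ℕ) (k : ℕ) (S≤a : card S ≤ a)
        (consistent : ∀ {i j} → E i j → Q i ∨ Y i ≡ true → Q j ∨ Y j ≡ true →
                      S i ≡ false → S j ≡ false → c i ≡ c j)
        (light : 2 * card (cls (λ i → Q i ∨ Y i) S c k) ≤ card (λ i → Q i ∨ Y i))
        (hv : Heavy (cls Q S c k)) where

        private
          V C Q₁ W₁ W₂ Y₁ M : Sets n
          V i = Q i ∨ Y i
          C = cls V S c k
          Q₁ i = Q i ∧ C i
          W₁ i = W i ∧ C i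
          W₂ i = W i ∧ not (C i)
          Y₁ i = Y i ∧ C i
          M i = W₂ i ∨ S i

        cls⊆ : ∀ i → cls Q S c k i ≡ true → Q₁ i ≡ true
        cls⊆ i h with cls-elim Q S c {k} {i} h
        ... | Qi , Si , ci = ∧-true Qi (cls-true V S c (∨-trueˡ Qi) Si ci)

        stays : ∀ {i j} → E i j → C i ≡ true → V j ≡ true → S j ≡ false → C j ≡ true
        stays {i} Eij Ci Vj Sj with cls-elim V S c {k} {i} Ci
        ... | Vi , Si , ci = cls-true V S c Vj Sj (≡.trans (≡.sym (consistent Eij Vi Vj Si Sj)) ci)

        card-W₁∪S : card (λ i → W₁ i ∨ S i) ≤ card W₁ + card S
        card-W₁∪S = wt-≤-+ (const 1) (λ i → W₁ i ∨ S i) W₁ S λ i →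
          bool₂ (λ x y → ⟦ x ∨ y ⟧) (λ x y → ⟦ x ⟧ + ⟦ y ⟧) (W₁ i) (S i)

        R₁ : Region Q₁ (λ i → W₁ i ∨ S i)
        R₁ .heavy = ≤-trans hv (*-monoʳ-≤ 2 (wt-mono w (cls Q S c k) Q₁ cls⊆))
        R₁ .small = ≤-trans card-W₁∪S (≤-trans (+-mono-≤
          (wt-mono (const 1) W₁ W λ i → ∧-conicalˡ (W i) _) S≤a) room)
        R₁ .disjoint {i} h = cong₂ _∨_
          (cong (_∧ C i) (disjoint R (∧-conicalˡ (Q i) _ h)))
          (proj₁ (proj₂ (cls-elim V S c {k} {i} (∧-conicalʳ (Q i) _ h))))
        R₁ .closed {i} {j} Eij h with true? (S j)
        ... | inj₁ Sj = ∨-trueʳ (Q₁ j) (∨-trueʳ (W₁ j) Sj)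
        ... | inj₂ Sj with ∨-elim {Q j} (closed R Eij (∧-conicalˡ (Q i) _ h))
        ...   | inj₁ Qj = ∨-trueˡ (∧-true Qj (stays Eij (∧-conicalʳ (Q i) _ h) (∨-trueˡ Qj) Sj))
        ...   | inj₂ Wj = ∨-trueʳ (Q₁ j) (∨-trueˡ
                (∧-true Wj (stays Eij (∧-conicalʳ (Q i) _ h) (∨-trueʳ (Q j) (W⊆Y j Wj)) Sj)))

        cut : Cut Y W Y₁ M
        cut .inside i = ∧-conicalˡ (Y i) _
        cut .source i Wi h = ∨-trueˡ (∧-true Wi (not-true (C-false h)))
          where
          C-false : Y i ∧ C i ≡ false → C i ≡ false
          C-false rewrite W⊆Y i Wi = id
        cut .border {i} {j} Eij h Yj with true? (S j)
        ... | inj₁ Sj = ∨-trueʳ (Y₁ j) (∨-trueʳ (W₂ j) Sj)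
        ... | inj₂ Sj = ∨-trueˡ (∧-true Yj (stays Eij (∧-conicalʳ (Y i) _ h) (∨-trueʳ (Q j) Yj) Sj))

        split : card W ≤ 4 * a
        split = *-cancelˡ-≤ μ ⦃ >-nonZero μ>0 ⦄ (≤-trans μW≤Y (≤-trans (m≤n+m (card Y) (card Q))
          (arithmetic (card Q) (card Y) (card Q₁) (card Y₁) (card W₁) (card W₂)
            μ (card S) a region-minimal cut-large C-light S≤a)))
          where
          region-minimal : card Q + μ * (card W₁ + card W₂) ≤ card Q₁ + μ * (card W₁ + card S)
          region-minimal = ≤-trans
            (+-monoʳ-≤ (card Q) (*-monoʳ-≤ μ (wt-+-≤ (const 1) W₁ W₂ W λ i →
              bool₂ (λ x y → ⟦ x ∧ y ⟧ + ⟦ x ∧ not y ⟧) (λ x y → ⟦ x ⟧) (W i) (C i))))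
            (≤-trans (minimal Q₁ _ R₁) (+-monoʳ-≤ (card Q₁) (*-monoʳ-≤ μ card-W₁∪S)))
          cut-large : card Y ≤ card Y₁ + μ * (card W₂ + card S)
          cut-large = ≤-trans (fed Y₁ M cut) (+-monoʳ-≤ (card Y₁) (*-monoʳ-≤ μ
            (wt-≤-+ (const 1) M W₂ S λ i →
              bool₂ (λ x y → ⟦ x ∨ y ⟧) (λ x y → ⟦ x ⟧ + ⟦ y ⟧) (W₂ i) (S i))))
          C-light : 2 * (card Q₁ + card Y₁) ≤ card Q + card Y
          C-light = ≤-trans (*-monoʳ-≤ 2 (wt-+-≤ (const 1) Q₁ Y₁ C disjoint-pieces)) (≤-trans light
            (wt-≤-+ (const 1) V Q Y λ i →
              bool₂ (λ x y → ⟦ x ∨ y ⟧) (λ x y → ⟦ x ⟧ + ⟦ y ⟧) (Q i) (Y i)))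
            where
            disjoint-pieces : ∀ i → ⟦ Q₁ i ⟧ + ⟦ Y₁ i ⟧ ≤ ⟦ C i ⟧
            disjoint-pieces i with true? (Y i)
            ... | inj₂ Yi rewrite Yi = ≤-trans (≤-reflexive (+-identityʳ _)) (⟦⟧-mono (∧-conicalʳ (Q i) _))
            ... | inj₁ Yi rewrite not-true⁻¹ (Y⊆ i Yi) = ⟦⟧-mono (∧-conicalʳ (Y i) _)
          -- In the sum of the first two inequalities `μ * w₁` and `μ * w₂` cancel, so `q + y` is at
          -- most `q₁ + y₁ + 2 * (μ * s)`; the third one bounds `q₁ + y₁` by half of `q + y`.
          arithmetic : ∀ q y q₁ y₁ w₁ w₂ μ s a →
            q + μ * (w₁ + w₂) ≤ q₁ + μ * (w₁ + s) → y ≤ y₁ + μ * (w₂ + s) →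
            2 * (q₁ + y₁) ≤ q + y → s ≤ a → q + y ≤ μ * (4 * a)
          arithmetic q y q₁ y₁ w₁ w₂ μ s a h₁ h₂ h₃ s≤a = ≤-trans
            (linear (q + y + 2 * (q₁ + y₁) + 2 * (μ * (w₁ + w₂)))
              (+-mono-≤ (*-monoʳ-≤ 2 (+-mono-≤ h₁ h₂)) h₃)
              (lhs q y q₁ y₁ w₁ w₂ μ) (rhs q y q₁ y₁ w₁ w₂ μ s))
            (*-monoʳ-≤ μ (*-monoʳ-≤ 4 s≤a))
            where
            lhs : ∀ q y q₁ y₁ w₁ w₂ μ →
              2 * (q + μ * (w₁ + w₂) + y) + 2 * (q₁ + y₁) ≡
              q + y + 2 * (q₁ + y₁) + 2 * (μ * (w₁ + w₂)) + (q + y)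
            lhs = solve-∀
            rhs : ∀ q y q₁ y₁ w₁ w₂ μ s →
              2 * (q₁ + μ * (w₁ + s) + (y₁ + μ * (w₂ + s))) + (q + y) ≡
              q + y + 2 * (q₁ + y₁) + 2 * (μ * (w₁ + w₂)) + μ * (4 * s)
            rhs = solve-∀

  -- With total weight 0 the empty separator would do.
  w>0 : 0 < wt w full
  w>0 = n≢0⇒n>0 λ w≡0 → noSep
    ( (λ _ → false) , (λ _ → 0) , ≤-trans (≤-reflexive (wt-∅ {n} (const 1))) z≤n , (λ _ _ _ _ _ → ≡.refl)
    , λ k → ≤-trans (*-monoʳ-≤ 2 (≤-trans (wt-mono w (cls full (λ _ → false) (λ _ → 0) k) full λ _ _ → ≡.refl)
                                           (≤-reflexive w≡0))) z≤n)

  full-region : Region full (λ _ → false)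
  full-region .heavy = ≤-trans (m<m+n (wt w full) w>0) (≤-reflexive (lem (wt w full)))
    where
    lem : ∀ x → x + x ≡ 2 * x
    lem = solve-∀
  full-region .small = ≤-trans (≤-reflexive (wt-∅ {n} (const 1))) z≤n
  full-region .disjoint _ = ≡.refl
  full-region .closed _ _ = ≡.refl

  minimum : ∀ μ → ¬ ¬ ∃ λ Q → ∃ λ W → Region Q W × Minimal μ Q W
  minimum μ = do
    (Q , W) , R , minimal ← ¬¬-minimum (λ QW → Region (proj₁ QW) (proj₂ QW))
      (λ QW → φ μ (proj₁ QW) (proj₂ QW)) (_ , full-region)
    return (Q , W , R , λ Q′ W′ R′ → minimal (Q′ , W′) R′)

  room : ∀ {x} → x ≤ 8 * a → x + a ≤ 9 * a
  room x≤ = ≤-trans (+-monoˡ-≤ a x≤) (≤-reflexive (+-comm (8 * a) a))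

  -- Halving `Q` saves half of `card Q` and costs at most `μ * a`; by minimality the saving cannot
  -- exceed the cost.
  low-bound : ∀ {Q W} μ → Region Q W → Minimal μ Q W → card W ≤ 8 * a → ¬ ¬ card Q ≤ 2 * (μ * a)
  low-bound {Q} {W} μ R minimal W≤ = do
    Q′ , W′ , R′ , half , W′≤ ← halve R (room W≤)
    return (arithmetic (card Q) (card W) (card Q′) (card W′) half W′≤ (minimal Q′ W′ R′))
    where
    arithmetic : ∀ q w q′ w′ → 2 * q′ ≤ q → w′ ≤ w + a → q + μ * w ≤ q′ + μ * w′ → q ≤ 2 * (μ * a)
    arithmetic q w q′ w′ h₁ h₂ h₃ =
      linear (q + 2 * q′ + 2 * (μ * w))
        (+-mono-≤ (*-monoʳ-≤ 2 (≤-trans h₃ (+-monoʳ-≤ q′ (*-monoʳ-≤ μ h₂)))) h₁)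
        (lhs q w q′ μ) (rhs q w q′ μ a)
      where
      lhs : ∀ q w q′ μ → 2 * (q + μ * w) + 2 * q′ ≡ q + 2 * q′ + 2 * (μ * w) + q
      lhs = solve-∀
      rhs : ∀ q w q′ μ a → 2 * (q′ + μ * (w + a)) + q ≡ q + 2 * q′ + 2 * (μ * w) + 2 * (μ * a)
      rhs = solve-∀

  -- By minimal-low a minimiser has boundary at most 4a or more than 8a; since
  -- consecutive μ cannot jump from one alternative to the other, all are high.
  High : ℕ → Set p
  High μ = ∀ {Q W} → Region Q W → Minimal μ Q W → 8 * a < card W

  high : ∀ μ → ¬ ¬ High (suc μ)
  high μ k = k λ {Q} {W} R minimal → ≰⇒> λ W≤ →
    low-bound (suc μ) R minimal W≤ λ Q≤ →
    minimal-low R (suc μ) (s≤s z≤n) minimal (room W≤) λ W≤4a → low μ R minimal W≤4a Q≤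
    where
    low : ∀ μ {Q W} → Region Q W → Minimal (suc μ) Q W → card W ≤ 4 * a →
          card Q ≤ 2 * (suc μ * a) → ⊥
    -- For the parameter 1, `Q` has at most 2a vertices, so removing all of `Q` and `W` takes at
    -- most 6a vertices and leaves nothing of `Q` that could be heavy.
    low zero {Q} {W} R minimal W≤ Q≤ = heavy-class R Q (λ _ → 0) (λ _ _ _ _ _ → ≡.refl)
      (≤-trans (+-mono-≤ W≤ Q≤) (≤-trans (≤-reflexive (lem₁ a)) (*-monoˡ-≤ a {6} {9} (m≤m+n 6 3))))
      λ (c , hv) → <⇒≱ hv (≤-trans (*-monoʳ-≤ 2 (wt-mono w (cls Q Q (λ _ → 0) c) (λ _ → false) (empty {c})))
        (≤-trans (≤-reflexive (cong (2 *_) (wt-∅ w))) z≤n))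
      where
      lem₁ : ∀ a → 4 * a + 2 * (1 * a) ≡ 6 * a
      lem₁ = solve-∀
      empty : ∀ {k} i → cls Q Q (λ _ → 0) k i ≡ true → false ≡ true
      empty {k} i h with cls-elim Q Q (λ _ → 0) {k} {i} h
      ... | Qi , Qi′ , _ = ⊥-elim (true≢false Qi Qi′)
    -- A minimiser for the preceding parameter is compared with `Q`, which is cheap for that
    -- parameter too.
    low (suc μ) {Q} {W} R minimal W≤ Q≤ =
      minimum (suc μ) λ (Q₁ , W₁ , R₁ , minimal₁) →
      high μ λ hi →
      <⇒≱ (hi R₁ minimal₁) (jump (card Q) (card W) (card Q₁) (card W₁) W≤ Q≤ (minimal₁ Q W R))
      where
      -- With the parameter `suc μ`, `Q` costs at most 2(μ+2)a + 4(μ+1)a, which is at most 8(μ+1)a.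
      jump : ∀ q w q₁ w₁ → w ≤ 4 * a → q ≤ 2 * (suc (suc μ) * a) →
             q₁ + suc μ * w₁ ≤ q + suc μ * w → w₁ ≤ 8 * a
      jump q w q₁ w₁ h₁ h₂ h₃ = *-cancelˡ-≤ (suc μ) (begin
        suc μ * w₁                                       ≤⟨ m≤n+m _ q₁ ⟩
        q₁ + suc μ * w₁                                  ≤⟨ h₃ ⟩
        q + suc μ * w                                    ≤⟨ +-mono-≤ h₂ (*-monoʳ-≤ (suc μ) h₁) ⟩
        2 * (suc (suc μ) * a) + suc μ * (4 * a)          ≤⟨ m≤m+n _ (2 * (μ * a)) ⟩
        2 * (suc (suc μ) * a) + suc μ * (4 * a) + 2 * (μ * a) ≡⟨ lem₂ μ a ⟩
        suc μ * (8 * a)                                  ∎)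
        where
        open ≤-Reasoning
        lem₂ : ∀ μ a → 2 * ((1 + (1 + μ)) * a) + (1 + μ) * (4 * a) + 2 * (μ * a) ≡ (1 + μ) * (8 * a)
        lem₂ = solve-∀

  contradictory : ⊥
  -- At the parameter `suc n` a minimiser has nonempty boundary and costs at least `suc n`, whereas
  -- `full-region` costs only `n`.
  contradictory = minimum (suc n) λ (Q , W , R , minimal) → high n λ hi → <⇒≱ (begin-strict
    n                                          <⟨ ≤-refl ⟩
    suc n                                      ≡⟨ *-identityʳ (suc n) ⟨
    suc n * 1                                  ≤⟨ *-monoʳ-≤ (suc n) (≤-trans (s≤s z≤n) (hi R minimal)) ⟩
    suc n * card W                             ≤⟨ m≤n+m _ (card Q) ⟩
    card Q + suc n * card W                    ≤⟨ minimal full (λ _ → false) full-region ⟩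
    card {n} full + suc n * card {n} (λ _ → false) ∎)
    (≤-reflexive (≡.trans (cong₂ _+_ (card-full n)
      (≡.trans (cong (suc n *_) (wt-∅ {n} (const 1))) (*-zeroʳ (suc n)))) (+-identityʳ n)))
    where open ≤-Reasoning

-- A variant of the theorem of Dvořák and Norin that separation number bounds
-- treewidth linearly.
weighted-separator : (E : Fin n → Fin n → Set p) → (∀ {i j} → E i j → E j i) → ∀ a →
  (∀ Y → ¬ ¬ Sep E Y (λ _ → 1) a) → ∀ w → ¬ ¬ Sep E full w (9 * a)
weighted-separator E E-sym a separate w = WeightedSeparator.contradictory E E-sym a separate w

-- The alternative `i ≡ j` absorbs loops, which come from trivial generators and from generators
-- killed by a retraction.
Sep-mono : {E : Fin n → Fin n → Set p} {E′ : Fin n → Fin n → Set q}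
  {Y : Sets n} {w : Fin n → ℕ} {b b′ : ℕ} → b ≤ b′ →
  (∀ {i j} → E′ i j → i ≡ j ⊎ E i j) → Sep E Y w b → Sep E′ Y w b′
Sep-mono b≤b′ sub (S , c , S≤b , consistent , light) =
  S , c , ≤-trans S≤b b≤b′ , (λ Eij → consistent′ (sub Eij)) , light
  where
  consistent′ : ∀ {i j} → i ≡ j ⊎ _ → _ → _ → _ → _ → c i ≡ c j
  consistent′ (inj₁ ≡.refl) _ _ _ _ = ≡.refl
  consistent′ (inj₂ Eij) = consistent Eij

-- Induced subgraphs, reindexed by their own vertices

record Enumeration {n} (Y : Sets n) : Set where
  field
    size      : ℕ
    elem      : Fin size → Fin n
    injective : ∀ {i j} → elem i ≡ elem j → i ≡ j
    sound     : ∀ i → Y (elem i) ≡ true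
    complete  : ∀ {j} → Y j ≡ true → ∃ λ i → elem i ≡ j
    -- Stated for all `f`, this transports cardinalities, total weights and weights of classes
    -- alike.
    sum-elem  : ∀ f → sum (f ∘ elem) ≡ sum λ j → ⟦ Y j ⟧ * f j

enumerate : (Y : Sets n) → Enumeration Y
enumerate {zero} Y = record
  { size = 0 ; elem = λ () ; injective = λ { {()} } ; sound = λ ()
  ; complete = λ { {()} } ; sum-elem = λ _ → ≡.refl }
enumerate {suc n} Y with Y zero in Y0 | enumerate (Y ∘ suc)
... | false | record { size = m ; elem = e ; injective = inj ; sound = snd ; complete = cmp ; sum-elem = sm } = record
  { size = m ; elem = suc ∘ e ; injective = inj ∘ Fin.suc-injective ; sound = snd ; complete = complete′
  ; sum-elem = λ f → ≡.trans (sm (f ∘ suc)) (cong (λ b → ⟦ b ⟧ * f zero + sum (λ j → ⟦ Y (suc j) ⟧ * f (suc j))) (≡.sym Y0)) }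
  where
  complete′ : ∀ {j} → Y j ≡ true → ∃ λ i → suc (e i) ≡ j
  complete′ {zero}  h = ⊥-elim (true≢false h Y0)
  complete′ {suc j} h = let i , eq = cmp h in i , cong suc eq
... | true | record { size = m ; elem = e ; injective = inj ; sound = snd ; complete = cmp ; sum-elem = sm } = record
  { size = suc m ; elem = e′ ; injective = injective′ ; sound = λ { zero → Y0 ; (suc i) → snd i }
  ; complete = complete′
  ; sum-elem = λ f → cong₂ _+_ (≡.trans (≡.sym (*-identityˡ (f zero))) (cong (λ b → ⟦ b ⟧ * f zero) (≡.sym Y0))) (sm (f ∘ suc)) }
  where
  e′ : Fin (suc m) → Fin (suc n)
  e′ zero    = zero
  e′ (suc i) = suc (e i)
  injective′ : ∀ {i j} → e′ i ≡ e′ j → i ≡ j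
  injective′ {zero}  {zero}  _ = ≡.refl
  injective′ {suc i} {suc j} h = cong suc (inj (Fin.suc-injective h))
  complete′ : ∀ {j} → Y j ≡ true → ∃ λ i → e′ i ≡ j
  complete′ {zero}  h = zero , ≡.refl
  complete′ {suc j} h = let i , eq = cmp h in suc i , cong suc eq

card-size : {Y : Sets n} (En : Enumeration Y) → Enumeration.size En ≡ card Y
card-size En = ≡.trans (≡.sym (card-full (Enumeration.size En))) (Enumeration.sum-elem En (const 1))

module _ {n} {E : Fin n → Fin n → Set p} {Y : Sets n} (En : Enumeration Y) where
  open Enumeration En

  private
    extend : A → (Fin size → A) → Fin n → A
    extend d f j with true? (Y j)
    ... | inj₁ Yj = f (proj₁ (complete Yj))
    ... | inj₂ _  = d

    extend-elem : (d : A) (f : Fin size → A) → ∀ i → extend d f (elem i) ≡ f i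
    extend-elem d f i with true? (Y (elem i))
    ... | inj₁ Yi = cong f (injective (proj₂ (complete Yi)))
    ... | inj₂ Yi = ⊥-elim (true≢false (sound i) Yi)

    extend-⊆ : (f : Fin size → Bool) → ∀ j → extend false f j ≡ true → Y j ≡ true
    extend-⊆ f j h with true? (Y j)
    ... | inj₁ Yj = Yj

  Sep-reindex : ∀ {w b} → Sep (λ i j → E (elem i) (elem j)) full (w ∘ elem) b → Sep E Y w b
  Sep-reindex {w} {b} (S , c , S≤b , consistent , light) = S′ , c′ , S′≤b , consistent′ , light′
    where
    S′ : Sets n
    -- Vertices outside `Y` stay out of the separator, so its size is unchanged.
    S′ = extend false S
    c′ : Fin n → ℕ
    c′ = extend 0 c
    S′≤b : card S′ ≤ b
    S′≤b = begin
      sum (λ j → ⟦ S′ j ⟧ * 1)               ≤⟨ sum-mono below-Y ⟩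
      sum (λ j → ⟦ Y j ⟧ * (⟦ S′ j ⟧ * 1))   ≡⟨ sum-elem (λ j → ⟦ S′ j ⟧ * 1) ⟨
      sum (λ i → ⟦ S′ (elem i) ⟧ * 1)        ≡⟨ sum-cong-≗ (λ i → cong (λ b → ⟦ b ⟧ * 1) (extend-elem false S i)) ⟩
      card S                                 ≤⟨ S≤b ⟩
      b                                      ∎
      where
      open ≤-Reasoning
      below-Y : ∀ j → ⟦ S′ j ⟧ * 1 ≤ ⟦ Y j ⟧ * (⟦ S′ j ⟧ * 1)
      below-Y j with S′ j in S′j
      ... | false = z≤n
      ... | true rewrite extend-⊆ S j S′j = ≤-refl
    consistent′ : ∀ {i j} → E i j → Y i ≡ true → Y j ≡ true → S′ i ≡ false → S′ j ≡ false → c′ i ≡ c′ j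
    consistent′ Eij Yi Yj Si Sj with complete Yi | complete Yj
    ... | i , ≡.refl | j , ≡.refl = begin
      c′ (elem i) ≡⟨ extend-elem 0 c i ⟩
      c i         ≡⟨ consistent Eij ≡.refl ≡.refl (≡.trans (≡.sym (extend-elem false S i)) Si)
                                              (≡.trans (≡.sym (extend-elem false S j)) Sj) ⟩
      c j         ≡⟨ extend-elem 0 c j ⟨
      c′ (elem j) ∎
      where open ≡-Reasoning
    light′ : ∀ k → 2 * wt w (cls Y S′ c′ k) ≤ wt w Y
    light′ k = subst₂ _≤_ (cong (2 *_) (≡.sym class-sum)) full-sum (light k)
      where
      open ≡-Reasoning
      full-sum : wt (w ∘ elem) full ≡ wt w Y
      full-sum = ≡.trans (sum-cong-≗ (λ i → *-identityˡ (w (elem i)))) (sum-elem w)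
      class-sum : wt w (cls Y S′ c′ k) ≡ wt (w ∘ elem) (cls full S c k)
      class-sum = begin
        sum (λ j → ⟦ Y j ∧ rest j ⟧ * w j)         ≡⟨ sum-cong-≗ (λ j → ∧-* (Y j) (rest j) (w j)) ⟩
        sum (λ j → ⟦ Y j ⟧ * (⟦ rest j ⟧ * w j))   ≡⟨ sum-elem (λ j → ⟦ rest j ⟧ * w j) ⟨
        sum (λ i → ⟦ rest (elem i) ⟧ * w (elem i)) ≡⟨ sum-cong-≗ (λ i → cong₂ (λ s x → ⟦ not s ∧ (x ≡ᵇ k) ⟧ * w (elem i))
                                                      (extend-elem false S i) (extend-elem 0 c i)) ⟩
        wt (w ∘ elem) (cls full S c k)             ∎
        where
        rest : Fin n → Bool
        rest j = not (S′ j) ∧ (c′ j ≡ᵇ k)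
        ∧-* : ∀ x y z → ⟦ x ∧ y ⟧ * z ≡ ⟦ x ⟧ * (⟦ y ⟧ * z)
        ∧-* false y z = ≡.refl
        ∧-* true  y z = ≡.sym (+-identityʳ _)

-- Cutsets and labellings

∣∣≡card : (S : Subset n) → ∣ S ∣ ≡ card (lookup S)
∣∣≡card []          = ≡.refl
∣∣≡card (true  ∷ S) = cong suc (∣∣≡card S)
∣∣≡card (false ∷ S) = ∣∣≡card S

∉-false : (S : Subset n) {i : Fin n} → lookup S i ≡ false → i ∉ S
∉-false S Si i∈S = true≢false ([]=⇒lookup i∈S) Si

false-∉ : (S : Subset n) {i : Fin n} → i ∉ S → lookup S i ≡ false
false-∉ S {i} i∉S with true? (lookup S i)
... | inj₁ Si = ⊥-elim (i∉S (lookup⇒[]= i S Si))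
... | inj₂ Si = Si

-- Labels a component by its least vertex, so that equal components get equal labels.
first : (Fin n → Bool) → ℕ
first {zero}  P = 0
first {suc n} P = if P zero then 0 else suc (first (P ∘ suc))

first-cong : {P Q : Fin n → Bool} → (∀ i → P i ≡ Q i) → first P ≡ first Q
first-cong {zero}  h = ≡.refl
first-cong {suc n} h = cong₂ (λ b x → if b then 0 else suc x) (h zero) (first-cong (h ∘ suc))

first-holds : (P : Fin n → Bool) {i : Fin n} → P i ≡ true → ∃ λ j → P j ≡ true × toℕ j ≡ first P
first-holds {suc n} P {i} Pi with P zero in P0 | i
... | true  | _ = zero , P0 , ≡.refl
... | false | zero = ⊥-elim (true≢false Pi P0)
... | false | suc i′ = let j , Pj , eq = first-holds (P ∘ suc) Pi in suc j , Pj , cong suc eq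

module _ (Γ : FiniteGraph) where
  open FiniteGraph Γ

  Sep⇒IsCutset : ∀ {b} → Sep _~_ full (const 1) b → ∃ λ S → IsCutset Γ S × ∣ S ∣ ≤ b
  Sep⇒IsCutset {b} (S′ , c , S≤b , consistent , light) = S , cutset , S-small
    where
    S : Subset order
    S = tabulate S′
    S-small : ∣ S ∣ ≤ b
    S-small = ≤-trans (≤-reflexive (≡.trans (∣∣≡card S)
      (sum-cong-≗ λ i → cong (λ b → ⟦ b ⟧ * 1) (lookup∘tabulate S′ i)))) S≤b
    S-false : ∀ {i} → i ∉ S → S′ i ≡ false
    S-false {i} i∉S = ≡.trans (≡.sym (lookup∘tabulate S′ i)) (false-∉ S i∉S)
    same-label : ∀ {i j} → Star (EdgeAvoiding Γ S) i j → i ∉ S → c i ≡ c j × j ∉ S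
    same-label done i∉S = ≡.refl , i∉S
    same-label ((i∉S , j∉S , i~j) ◅ path) _ =
      let eq , k∉S = same-label path j∉S in
      ≡.trans (consistent i~j ≡.refl ≡.refl (S-false i∉S) (S-false j∉S)) eq , k∉S
    cutset : IsCutset Γ S
    cutset C (i , i∉S , component) = begin
      2 * ∣ C ∣                          ≡⟨ cong (2 *_) (∣∣≡card C) ⟩
      2 * card (lookup C)                ≤⟨ *-monoʳ-≤ 2 (wt-mono (const 1) (lookup C) (cls full S′ c (c i)) in-class) ⟩
      2 * card (cls full S′ c (c i))     ≤⟨ light (c i) ⟩
      card {order} full                  ≡⟨ card-full order ⟩
      order                              ∎
      where
      open ≤-Reasoning
      in-class : ∀ j → lookup C j ≡ true → cls full S′ c (c i) j ≡ true
      in-class j Cj = let eq , j∉S = same-label (Equivalence.to (component j) (lookup⇒[]= j C Cj)) i∉S in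
        cls-true full S′ c ≡.refl (S-false j∉S) (≡.sym eq)

  IsCutset⇒Sep : ∀ {S} → IsCutset Γ S → ¬ ¬ Sep _~_ full (const 1) ∣ S ∣
  IsCutset⇒Sep {S} cutset = do
    reach? ← ¬¬-∀ λ i → ¬¬-∀ λ j → em (Star (EdgeAvoiding Γ S) i j)
    return (labelling reach?)
    where
    module _ (reach? : ∀ i j → Dec (Star (EdgeAvoiding Γ S) i j)) where
      c : Fin order → ℕ
      c i = first (does ∘ reach? i)

      does-true : ∀ {i j} → Star (EdgeAvoiding Γ S) i j → does (reach? i j) ≡ true
      does-true {i} {j} s with reach? i j
      ... | yes _ = ≡.refl
      ... | no ¬s = ⊥-elim (¬s s)

      true-does : ∀ {i j} → does (reach? i j) ≡ true → Star (EdgeAvoiding Γ S) i j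
      true-does {i} {j} h with reach? i j
      ... | yes s = s

      backward : ∀ {i j} → Star (EdgeAvoiding Γ S) i j → Star (EdgeAvoiding Γ S) j i
      backward = reverse λ (i∉S , j∉S , i~j) → j∉S , i∉S , ~-sym i~j

      label-cong : ∀ {i j} → Star (EdgeAvoiding Γ S) i j → c i ≡ c j
      label-cong {i} {j} s = first-cong λ k → same (true? (does (reach? i k))) (true? (does (reach? j k)))
        where
        same : ∀ {k} → does (reach? i k) ≡ true ⊎ does (reach? i k) ≡ false →
               does (reach? j k) ≡ true ⊎ does (reach? j k) ≡ false →
               does (reach? i k) ≡ does (reach? j k)
        same (inj₁ h) _ = ≡.trans h (≡.sym (does-true (backward s ◅◅ true-does h)))
        same _ (inj₁ h) = ≡.trans (does-true (s ◅◅ true-does h)) (≡.sym h)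
        same (inj₂ h) (inj₂ h′) = ≡.trans h (≡.sym h′)

      label-injective : ∀ {i j} → c i ≡ c j → Star (EdgeAvoiding Γ S) i j
      label-injective {i} {j} eq
        with first-holds (does ∘ reach? i) (does-true done) | first-holds (does ∘ reach? j) (does-true done)
      ... | x , ix , x≡ | y , jy , y≡ =
        true-does ix ◅◅ backward (subst (Star _ j) (Fin.toℕ-injective (≡.trans y≡ (≡.trans (≡.sym eq) (≡.sym x≡)))) (true-does jy))

      labelling : Sep _~_ full (const 1) ∣ S ∣
      labelling = lookup S , c , ≤-reflexive (≡.sym (∣∣≡card S))
        , (λ i~j _ _ Si Sj → label-cong ((∉-false S Si , ∉-false S Sj , i~j) ◅ done))
        , light
        where
        light : ∀ k → 2 * card (cls full (lookup S) c k) ≤ card {order} full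
        light k with Fin.any? (λ i → cls full (lookup S) c k i Bool.≟ true)
        -- `IsCutset` speaks only of components with a vertex in them, so labels carried by no
        -- vertex are treated apart.
        ... | no none = ≤-trans (≤-reflexive (≡.trans (cong (2 *_) (n≤0⇒n≡0 (≤-trans
                (wt-mono (const 1) (cls full (lookup S) c k) (λ _ → false) λ i h → ⊥-elim (none (i , h)))
                (≤-reflexive (wt-∅ {order} (const 1)))))) (*-zeroʳ 2))) z≤n
        ... | yes (i , h) with cls-elim full (lookup S) c {k} {i} h
        ...   | _ , Si , ≡.refl = begin
          2 * card (cls full (lookup S) c (c i)) ≤⟨ *-monoʳ-≤ 2 (wt-mono (const 1) (cls full (lookup S) c (c i)) (lookup C) in-C) ⟩
          2 * card (lookup C)                    ≡⟨ cong (2 *_) (∣∣≡card C) ⟨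
          2 * ∣ C ∣                              ≤⟨ cutset C (i , ∉-false S Si , component) ⟩
          order                                  ≡⟨ card-full order ⟨
          card {order} full                      ∎
          where
          open ≤-Reasoning
          C : Subset order
          C = tabulate (does ∘ reach? i)
          in-C : ∀ j → cls full (lookup S) c (c i) j ≡ true → lookup C j ≡ true
          in-C j h′ = ≡.trans (lookup∘tabulate (does ∘ reach? i) j)
            (does-true (backward (label-injective (proj₂ (proj₂ (cls-elim full (lookup S) c {c i} {j} h′))))))
          component : ∀ j → j ∈ C ⇔ Star (EdgeAvoiding Γ S) i j
          component j = mk⇔
            (λ j∈C → true-does (≡.trans (≡.sym (lookup∘tabulate (does ∘ reach? i) j)) ([]=⇒lookup j∈C)))
            (λ s → lookup⇒[]= j C (≡.trans (lookup∘tabulate (does ∘ reach? i) j) (does-true s)))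

-- Separation profiles and balanced separators

module _ {X : Graph v ℓ e} {f : ℕ → ℕ} (profile : IsSeparationProfile X f) where
  private
    module X = Graph X

  profile-upper : ∀ {b} r → (∀ (Γ : FiniteGraph) → Γ ≤ᴳ X → FiniteGraph.order Γ ≤ r →
    ¬ ¬ Sep (FiniteGraph._~_ Γ) full (const 1) b) → f r ≤ b
  profile-upper {b} r separate with profile r
  ... | (Γ , Γ≤X , order≤r , _ , minimal) , _ = ≮⇒≥ λ b<f → separate Γ Γ≤X order≤r λ sep →
    let S , cutset , S≤b = Sep⇒IsCutset Γ sep in
    <⇒≱ b<f (≤-trans (minimal _ (S , cutset , ≡.refl)) S≤b)

  profile-separates : ∀ {N} → n ≤ N → (v : Fin n → X.Vertex) → Injective _≡_ X._≈_ v →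
    ¬ ¬ Sep (λ i j → v i X.~ v j) full (const 1) (f N)
  profile-separates {n} {N} n≤N v v-injective = do
    -- A `FiniteGraph` has decidable edges. Those between finitely many vertices can be decided
    -- under the double negation, and `True` then brings the relation down to level 0.
    edge? ← ¬¬-∀ λ i → ¬¬-∀ λ j → em (v i X.~ v j)
    S , cutset , minimal ← ¬¬-minimum (IsCutset (Γ edge?)) ∣_∣
      (⊤ , λ { _ (_ , i∉⊤ , _) → ⊥-elim (i∉⊤ ∈⊤) })
    sep ← IsCutset⇒Sep (Γ edge?) cutset
    let S≤f = proj₂ (profile N) ∣ S ∣ (Γ edge? , record
          { embed = v ; injective = v-injective ; edges = toWitness } , n≤N
          , (S , cutset , ≡.refl) , λ { _ (S′ , cutset′ , ≡.refl) → minimal S′ cutset′ })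
    return (restore edge? (Sep-mono S≤f inj₂ sep))
    where
    module _ (edge? : ∀ i j → Dec (v i X.~ v j)) where
      Γ : FiniteGraph
      Γ = record
        { order = n ; _~_ = λ i j → True (edge? i j) ; ~-dec = λ i j → T? _
        ; ~-sym = λ i~j → fromWitness (X.~-sym (toWitness i~j))
        ; ~-irrefl = λ { ≡.refl i~i → X.~-irrefl X.≈-refl (toWitness i~i) } }
      restore : ∀ {b} → Sep (FiniteGraph._~_ Γ) full (const 1) b →
                Sep (λ i j → v i X.~ v j) full (const 1) b
      restore (S , c , S≤ , consistent , light) =
        S , c , S≤ , (λ Eij → consistent (fromWitness Eij)) , light

  profile-separates-weighted : ∀ {N} → n ≤ N → (v : Fin n → X.Vertex) → Injective _≡_ X._≈_ v →
    ∀ w → ¬ ¬ Sep (λ i j → v i X.~ v j) full w (9 * f N)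
  profile-separates-weighted {n} {N} n≤N v v-injective =
    weighted-separator (λ i j → v i X.~ v j) X.~-sym (f N) λ Y → do
      let En = enumerate Y
          open Enumeration En
      sep ← profile-separates (≤-trans (≤-reflexive (card-size En)) (≤-trans (card≤n Y) n≤N))
              (v ∘ elem) (injective ∘ v-injective)
      return (Sep-reindex En sep)

-- Paths through a group may meet, while `Separated` asks for distinct elements. The map `q`
-- remembers where each listed point went.
dedupe : (S : Setoid c₁ ℓ₁) (f : Fin n → Setoid.Carrier S) →
  ¬ ¬ ∃ λ m → m ≤ n × ∃ λ (v : Fin m → Setoid.Carrier S) → Injective _≡_ (Setoid._≈_ S) v ×
      ∃ λ (q : Fin n → Fin m) → ∀ x → Setoid._≈_ S (v (q x)) (f x)
dedupe {n = zero} S f = return (0 , z≤n , (λ ()) , (λ { {()} }) , (λ ()) , λ ())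
dedupe {n = suc n} S f = do
  m , m≤n , v , v-injective , q , vq≈f ← dedupe S (f ∘ suc)
  old? ← em (∃ λ x → v x ≈ f zero)
  return (extend m m≤n v v-injective q vq≈f old?)
  where
  open Setoid S
  extend : ∀ m → m ≤ n → (v : Fin m → Carrier) → Injective _≡_ _≈_ v → (q : Fin n → Fin m) →
    (∀ x → v (q x) ≈ f (suc x)) → Dec (∃ λ x → v x ≈ f zero) →
    ∃ λ m → m ≤ suc n × ∃ λ (v : Fin m → Carrier) → Injective _≡_ _≈_ v ×
      ∃ λ (q : Fin (suc n) → Fin m) → ∀ x → v (q x) ≈ f x
  extend m m≤n v v-injective q vq≈f (yes (x , vx≈f0)) =
    m , m≤n⇒m≤1+n m≤n , v , v-injective , (λ { zero → x ; (suc i) → q i }) , λ { zero → vx≈f0 ; (suc i) → vq≈f i }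
  extend m m≤n v v-injective q vq≈f (no new) =
    suc m , s≤s m≤n , v′ , injective′ , (λ { zero → zero ; (suc i) → suc (q i) }) , λ { zero → refl ; (suc i) → vq≈f i }
    where
    v′ : Fin (suc m) → Carrier
    v′ zero    = f zero
    v′ (suc x) = v x
    injective′ : Injective _≡_ _≈_ v′
    injective′ {zero}  {zero}  _ = ≡.refl
    injective′ {zero}  {suc y} h = ⊥-elim (new (y , sym h))
    injective′ {suc x} {zero}  h = ⊥-elim (new (x , h))
    injective′ {suc x} {suc y} h = cong suc (v-injective h)

-- Sums along maps of finite sets

card-unique : (Z : Sets n) → (∀ i j → Z i ≡ true → Z j ≡ true → i ≡ j) → card Z ≤ 1
card-unique {zero}  Z unique = z≤n
card-unique {suc n} Z unique with Z zero in Z0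
... | false = card-unique (Z ∘ suc) λ i j Zi Zj → Fin.suc-injective (unique (suc i) (suc j) Zi Zj)
... | true  = s≤s (≤-trans (wt-mono (const 1) (Z ∘ suc) (λ _ → false) λ i Zi → ⊥-elim (Fin.0≢1+n (unique zero (suc i) Z0 Zi)))
                           (≤-reflexive (wt-∅ {n} (const 1))))

δ-sum : (y : Fin n) (f : Fin n → ℕ) → sum (λ x → ⟦ does (y Fin.≟ x) ⟧ * f x) ≡ f y
δ-sum {suc n} zero f = ≡.trans (cong₂ _+_ (+-identityʳ (f zero)) (sum-zero n)) (+-identityʳ (f zero))
  where
  sum-zero : ∀ n → sum {n} (λ _ → 0) ≡ 0
  sum-zero zero    = ≡.refl
  sum-zero (suc n) = sum-zero n
δ-sum {suc n} (suc y) f = δ-sum y (f ∘ suc)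

sum-const : ∀ n x → sum {n} (λ _ → x) ≡ n * x
sum-const zero    x = ≡.refl
sum-const (suc n) x = cong (x +_) (sum-const n x)

some : (Fin n → Bool) → Bool
some P = does (Fin.any? λ i → P i Bool.≟ true)

some-false : (P : Fin n → Bool) → some P ≡ false → ∀ i → P i ≡ false
some-false P h i with Fin.any? (λ i → P i Bool.≟ true) | true? (P i)
... | no none | inj₁ Pi = ⊥-elim (none (i , Pi))
... | _       | inj₂ Pi = Pi

some≤card : (P : Fin n → Bool) → ⟦ some P ⟧ * 1 ≤ card P
some≤card P with Fin.any? (λ i → P i Bool.≟ true)
... | no _          = z≤n
... | yes (i , Pi) = ≤-trans (≤-reflexive (cong (λ b → ⟦ b ⟧ * 1) (≡.sym Pi)))
                             (term≤sum (λ i → ⟦ P i ⟧ * 1) i)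

fibre : (Fin n → Fin m) → Fin m → ℕ
fibre q x = card λ i → does (q i Fin.≟ x)

wt-fibre : (q : Fin n → Fin m) (f : Fin m → ℕ) → sum (λ x → f x * fibre q x) ≡ sum (f ∘ q)
wt-fibre q f = begin
  sum (λ x → f x * fibre q x)                                ≡⟨ sum-cong-≗ (λ x → *-distribˡ-sum (f x) (λ i → ⟦ does (q i Fin.≟ x) ⟧ * 1)) ⟩
  sum (λ x → sum λ i → f x * (⟦ does (q i Fin.≟ x) ⟧ * 1))   ≡⟨ ∑-comm (λ x i → f x * (⟦ does (q i Fin.≟ x) ⟧ * 1)) ⟩
  sum (λ i → sum λ x → f x * (⟦ does (q i Fin.≟ x) ⟧ * 1))   ≡⟨ sum-cong-≗ (λ i → ≡.trans
                                                                  (sum-cong-≗ λ x → ≡.trans (cong (f x *_) (*-identityʳ ⟦ does (q i Fin.≟ x) ⟧)) (*-comm (f x) ⟦ does (q i Fin.≟ x) ⟧))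
                                                                  (δ-sum (q i) f)) ⟩
  sum (f ∘ q)                                                ∎
  where open ≡-Reasoning

sum-injective : (q : Fin n → Fin m) → (∀ {i j} → q i ≡ q j → i ≡ j) → (f : Fin m → ℕ) → sum (f ∘ q) ≤ sum f
sum-injective q q-injective f = ≤-trans (≤-reflexive (≡.sym (wt-fibre q f)))
  (sum-mono λ x → ≤-trans (*-monoʳ-≤ (f x) (card-unique (λ i → does (q i Fin.≟ x)) (unique x)))
                          (≤-reflexive (*-identityʳ (f x))))
  where
  hit : ∀ {x i} → does (q i Fin.≟ x) ≡ true → q i ≡ x
  hit {x} {i} h with q i Fin.≟ x
  ... | yes eq = eq
  unique : ∀ x i j → does (q i Fin.≟ x) ≡ true → does (q j Fin.≟ x) ≡ true → i ≡ j
  unique x i j hi hj = q-injective (≡.trans (hit hi) (≡.sym (hit hj)))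

-- Adjacency and paths with respect to a family of group elements

module Adjacency (K : Group c₁ ℓ₁) {I : Set} (z : I → Group.Carrier K) where
  open Group K

  -- Unlike `CayleyEdge` this allows loops, so adjacency can be transported without checking that
  -- endpoints remain distinct.
  Adj : Carrier → Carrier → Set ℓ₁
  Adj x y = ∃ λ i → (y ≈ x ∙ z i) ⊎ (x ≈ y ∙ z i)

  Adj-sym : ∀ {x y} → Adj x y → Adj y x
  Adj-sym (i , h) = i , swap h

  -- The form in which a bound passes from one group to another. It includes all weights because
  -- both the simulation by paths and the cutting in the free product create weights.
  Separated : ℕ → ℕ → Set _
  Separated N b = ∀ {n} → n ≤ N → (v : Fin n → Carrier) → Injective _≡_ _≈_ v →
    ∀ w → ¬ ¬ Sep (λ i j → Adj (v i) (v j)) full w b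

  -- Standing still is a step: it changes representatives of an element and pads walks that have
  -- ended.
  Step : Carrier → Carrier → Set ℓ₁
  Step x y = x ≈ y ⊎ Adj x y

  Step-sym : ∀ {x y} → Step x y → Step y x
  Step-sym (inj₁ x≈y) = inj₁ (sym x≈y)
  Step-sym (inj₂ xy)  = inj₂ (Adj-sym xy)

  Step-∙ : ∀ g {x y} → Step x y → Step (g ∙ x) (g ∙ y)
  Step-∙ g (inj₁ x≈y)            = inj₁ (∙-congˡ x≈y)
  Step-∙ g (inj₂ (i , inj₁ y≈)) = inj₂ (i , inj₁ (trans (∙-congˡ y≈) (sym (assoc _ _ _))))
  Step-∙ g (inj₂ (i , inj₂ x≈)) = inj₂ (i , inj₂ (trans (∙-congˡ x≈) (sym (assoc _ _ _))))

  Path : Carrier → Carrier → Set _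
  Path = Star Step

  translate : ∀ g {x y} → Path x y → Path (g ∙ x) (g ∙ y)
  translate g = gmap (g ∙_) (Step-∙ g)

  Path-≈ : ∀ {x y y′} → Path x y → y ≈ y′ → Path x y′
  Path-≈ path y≈y′ = path ◅◅ (inj₁ y≈y′ ◅ done)

  Path-gen : ∀ i → Path ε (z i)
  Path-gen i = inj₂ (i , inj₁ (sym (identityˡ _))) ◅ done

  Path-∙ : ∀ {x y} → Path ε x → Path ε y → Path ε (x ∙ y)
  Path-∙ {x} p q = Path-≈ p (sym (identityʳ x)) ◅◅ translate x q

  Path-⁻¹ : ∀ {x} → Path ε x → Path ε (x ⁻¹)
  Path-⁻¹ {x} p = Path-≈ (inj₁ (sym (inverseˡ x)) ◅ reverse Step-sym (translate (x ⁻¹) p)) (identityʳ _)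

  -- Constant after the end of the path, so that all paths can be followed for the same number of
  -- steps.
  walk : ∀ {x y} → Path x y → ℕ → Carrier
  walk {x} done      k       = x
  walk {x} (s ◅ path) zero    = x
  walk {x} (s ◅ path) (suc k) = walk path k

  pathLength : ∀ {x y} → Path x y → ℕ
  pathLength done      = 0
  pathLength (s ◅ path) = suc (pathLength path)

  walk-start : ∀ {x y} (path : Path x y) → walk path 0 ≡ x
  walk-start done      = ≡.refl
  walk-start (s ◅ path) = ≡.refl

  walk-end : ∀ {x y} (path : Path x y) {k} → pathLength path ≤ k → walk path k ≡ y
  walk-end done      _       = ≡.refl
  walk-end (s ◅ path) (s≤s h) = walk-end path h

  walk-step : ∀ {x y} (path : Path x y) k → Step (walk path k) (walk path (suc k))
  walk-step done      k       = inj₁ refl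
  walk-step (s ◅ path) zero    rewrite walk-start path = s
  walk-step (s ◅ path) (suc k) = walk-step path k

module _ (F : Group c₁ ℓ₁) (K : Group c₂ ℓ₂) {I : Set} (z : I → Group.Carrier K) where
  private
    module F = Group F
    module K = Group K
  open GroupMorphisms F.rawGroup K.rawGroup using (IsGroupHomomorphism)
  open Adjacency K z

  Path-generated : ∀ {J : Set} {s : J → F.Carrier} {ι} → IsGroupHomomorphism ι →
    (∀ j → Path K.ε (ι (s j))) → ∀ {x} → Generated F s x → Path K.ε (ι x)
  Path-generated {s = s} {ι} hom gens = go
    where
    open IsGroupHomomorphism hom
    go : ∀ {x} → Generated F s x → Path K.ε (ι x)
    go (gen j)        = gens j
    go unit           = Path-≈ done (K.sym ε-homo)
    go (mul g h)      = Path-≈ (Path-∙ (go g) (go h)) (K.sym (homo _ _))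
    go (inv g)        = Path-≈ (Path-⁻¹ (go g)) (K.sym (⁻¹-homo _))
    go (resp x≈y g)   = Path-≈ (go g) (⟦⟧-cong x≈y)

-- Simulation of one family of generators by another

module Transfer (K : Group c₁ ℓ₁) {I : Set} (z : I → Group.Carrier K) {s : ℕ}
  (g : Fin s → Group.Carrier K) (path : ∀ l → Adjacency.Path K z (Group.ε K) (g l)) where
  open Group K
  open Adjacency K z
  open GroupProperties K using (∙-cancelʳ)

  L : ℕ
  L = sum (pathLength ∘ path)

  -- The number of positions on all paths. The additional row is the constant path at `ε`; it
  -- supplies a base point even if there are no generators.
  expansion : ℕ
  expansion = suc s * suc L

  private
    offset : Fin (suc s) → ℕ → Carrier
    offset zero    k = ε
    offset (suc l) k = walk (path l) k

    offset-step : ∀ l k → Step (offset l k) (offset l (suc k))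
    offset-step zero    k = inj₁ refl
    offset-step (suc l) k = walk-step (path l) k

    offset-start : ∀ l → offset l 0 ≡ ε
    offset-start zero    = ≡.refl
    offset-start (suc l) = walk-start (path l)

    offset-end : ∀ l → offset (suc l) L ≡ g l
    offset-end l = walk-end (path l) (term≤sum (pathLength ∘ path) l)

    step-label : Fin expansion → Carrier
    step-label α = let l , k = remQuot (suc L) α in offset l (toℕ k)

  -- The points on the translates of the paths by u i contain the vertices of the
  -- graph E; a separator of these points is pulled back to the indices whose
  -- translates it meets.
  transfer : ∀ {N b} → Separated N b → (E : Fin n → Fin n → Set p) (u : Fin n → Carrier) →
    Injective _≡_ _≈_ u → (∀ {i j} → E i j → Adjacency.Adj K g (u i) (u j)) →
    n * expansion ≤ N → ¬ ¬ Sep E full (const 1) (expansion * b)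
  transfer {n = n} {b = b} separated E u u-injective E⇒Adj n≤N = do
    m , m≤ , v , v-injective , q , vq≈ ← dedupe setoid points
    -- Only the points `u i` themselves carry weight, so the pieces are balanced with respect to the
    -- original vertices.
    sep ← separated (≤-trans m≤ n≤N) v v-injective (fibre (λ i → q (pair i base)))
    return (pull-back v v-injective q vq≈ sep)
    where
    pair : Fin n → Fin expansion → Fin (n * expansion)
    pair = combine
    points : Fin (n * expansion) → Carrier
    points x = let i , α = remQuot {n} expansion x in u i ∙ step-label α
    base : Fin expansion
    base = combine {suc s} {suc L} zero zero
    module _ {m} (v : Fin m → Carrier) (v-injective : Injective _≡_ _≈_ v)
      (q : Fin (n * expansion) → Fin m) (vq≈ : ∀ x → v (q x) ≈ points x) where

      at : Fin n → Fin (suc s) → Fin (suc L) → Fin m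
      at i l k = q (pair i (combine l k))

      v-at : ∀ i l k → v (at i l k) ≈ u i ∙ offset l (toℕ k)
      v-at i l k = trans (vq≈ _) (reflexive (≡.trans
        (cong (λ (i , α) → u i ∙ step-label α) (Fin.remQuot-combine i (combine l k)))
        (cong (λ (l , k) → u i ∙ offset l (toℕ k)) (Fin.remQuot-combine l k))))

      pull-back : Sep (λ x y → Adj (v x) (v y)) full (fibre (λ i → q (pair i base))) b →
                  Sep E full (const 1) (expansion * b)
      pull-back (S′ , c′ , S′≤b , consistent , light) = S , c , S≤ , E-consistent , E-light
        where
        S : Sets n
        S i = some λ α → S′ (q (pair i α))
        c : Fin n → ℕ
        c i = c′ (at i zero zero)

        S-false : ∀ {i} → S i ≡ false → ∀ α → S′ (q (pair i α)) ≡ false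
        S-false {i} = some-false λ α → S′ (q (pair i α))

        -- For a fixed position on the paths, distinct `i` give distinct points, so each vertex of
        -- `S′` is charged at most once per position.
        S≤ : card S ≤ expansion * b
        S≤ = begin
          card S                                                        ≤⟨ sum-mono {n} (λ i → some≤card λ α → S′ (q (pair i α))) ⟩
          sum (λ i → sum {expansion} λ α → ⟦ S′ (q (pair i α)) ⟧ * 1) ≡⟨ ∑-comm {n} {expansion} (λ i α → ⟦ S′ (q (pair i α)) ⟧ * 1) ⟩
          sum {expansion} (λ α → sum λ i → ⟦ S′ (q (pair i α)) ⟧ * 1) ≤⟨ sum-mono {expansion} (λ α →
                                                                             ≤-trans (sum-injective (λ i → q (pair i α)) (column-injective α) (λ x → ⟦ S′ x ⟧ * 1)) S′≤b) ⟩
          sum {expansion} (λ _ → b)                                     ≡⟨ sum-const expansion b ⟩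
          expansion * b                                                 ∎
          where
          open ≤-Reasoning
          column-injective : ∀ α {i j} → q (pair i α) ≡ q (pair j α) → i ≡ j
          column-injective α {i} {j} eq = u-injective (∙-cancelʳ (step-label α) (u i) (u j) (begin-equality′ eq))
            where
            begin-equality′ : q (pair i α) ≡ q (pair j α) → u i ∙ step-label α ≈ u j ∙ step-label α
            begin-equality′ eq = trans (sym (point i)) (trans (reflexive (cong v eq)) (point j))
              where
              point : ∀ i → v (q (pair i α)) ≈ u i ∙ step-label α
              point i = trans (vq≈ _) (reflexive (cong (λ (i , α) → u i ∙ step-label α) (Fin.remQuot-combine i α)))

        along : ∀ i l → S i ≡ false → ∀ k (k<1+L : k < suc L) → c i ≡ c′ (at i l (fromℕ< k<1+L))
        along i l Si zero (s≤s z≤n) = cong c′ (v-injective (trans (v-at i zero zero)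
          (trans (∙-congˡ (reflexive (≡.sym (offset-start l)))) (sym (v-at i l zero)))))
        along i l Si (suc k) 1+k<1+L = ≡.trans (along i l Si k k<1+L)
          (next (Step-∙ (u i) (offset-step l k)))
          where
          k<1+L = m<n⇒m<1+n (s≤s⁻¹ 1+k<1+L)
          x = at i l (fromℕ< k<1+L)
          y = at i l (fromℕ< 1+k<1+L)
          vx : v x ≈ u i ∙ offset l k
          vx = trans (v-at i l _) (reflexive (cong (λ k → u i ∙ offset l k) (Fin.toℕ-fromℕ< k<1+L)))
          vy : v y ≈ u i ∙ offset l (suc k)
          vy = trans (v-at i l _) (reflexive (cong (λ k → u i ∙ offset l k) (Fin.toℕ-fromℕ< 1+k<1+L)))
          next : Step (u i ∙ offset l k) (u i ∙ offset l (suc k)) → c′ x ≡ c′ y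
          next (inj₁ eq) = cong c′ (v-injective (trans vx (trans eq (sym vy))))
          next (inj₂ (r , h)) = consistent (r , respects h) ≡.refl ≡.refl (S-false Si _) (S-false Si _)
            where
            respects : _ ⊎ _ → _ ⊎ _
            respects (inj₁ h) = inj₁ (trans vy (trans h (∙-congʳ (sym vx))))
            respects (inj₂ h) = inj₂ (trans vx (trans h (∙-congʳ (sym vy))))

        -- The whole path from `u i` to `u j` belongs to the translate of `i`, so avoiding `S` is
        -- asked of `i` alone.
        across : ∀ i j l → S i ≡ false → u j ≈ u i ∙ g l → c i ≡ c j
        across i j l Si h = ≡.trans (along i (suc l) Si L ≤-refl) (cong c′ (v-injective (begin
          v (at i (suc l) (fromℕ< ≤-refl)) ≈⟨ v-at i (suc l) _ ⟩
          u i ∙ offset (suc l) (toℕ (fromℕ< (≤-refl {suc L}))) ≡⟨ cong (λ k → u i ∙ offset (suc l) k) (Fin.toℕ-fromℕ< ≤-refl) ⟩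
          u i ∙ offset (suc l) L           ≡⟨ cong (u i ∙_) (offset-end l) ⟩
          u i ∙ g l                        ≈⟨ h ⟨
          u j                              ≈⟨ identityʳ (u j) ⟨
          u j ∙ ε                          ≈⟨ v-at j zero zero ⟨
          v (at j zero zero)               ∎)))
          where open import Relation.Binary.Reasoning.Setoid setoid

        E-consistent : ∀ {i j} → E i j → true ≡ true → true ≡ true → S i ≡ false → S j ≡ false → c i ≡ c j
        E-consistent {i} {j} Eij _ _ Si Sj with E⇒Adj Eij
        ... | l , inj₁ h = across i j l Si h
        ... | l , inj₂ h = ≡.sym (across j i l Sj h)

        E-light : ∀ k → 2 * card (cls full S c k) ≤ card {n} full
        E-light k = begin
          2 * card (cls full S c k)                          ≤⟨ *-monoʳ-≤ 2 (wt-mono (const 1) (cls full S c k) (cls full S′ c′ k ∘ q₀) sub) ⟩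
          2 * card (cls full S′ c′ k ∘ q₀)                   ≡⟨ cong (2 *_) (card-fibre (cls full S′ c′ k)) ⟨
          2 * wt (fibre q₀) (cls full S′ c′ k)               ≤⟨ light k ⟩
          wt (fibre q₀) full                                 ≡⟨ card-fibre full ⟩
          card {n} full                                      ∎
          where
          open ≤-Reasoning
          q₀ : Fin n → Fin m
          q₀ i = q (pair i base)
          card-fibre : ∀ Z → wt (fibre q₀) Z ≡ card (Z ∘ q₀)
          card-fibre Z = ≡.trans (wt-fibre q₀ (λ x → ⟦ Z x ⟧)) (sum-cong-≗ λ i → ≡.sym (*-identityʳ ⟦ Z (q₀ i) ⟧))
          sub : ∀ i → cls full S c k i ≡ true → cls full S′ c′ k (q₀ i) ≡ true
          sub i h with cls-elim full S c {k} {i} h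
          ... | _ , Si , ci = cls-true full S′ c′ ≡.refl (S-false Si base) ci

module _ (K : Group c₁ ℓ₁) (S : FiniteGeneratingSet K) where
  open Group K
  open FiniteGeneratingSet S

  profile⇒Separated : ∀ {f} → IsSeparationProfile (Cayley K S) f → ∀ N →
    Adjacency.Separated K element N (9 * f N)
  profile⇒Separated profile N n≤N v v-injective w = do
    sep ← profile-separates-weighted profile n≤N v v-injective w
    return (Sep-mono ≤-refl proper sep)
    where
    proper : ∀ {i j} → Adjacency.Adj K element (v i) (v j) → i ≡ j ⊎ CayleyEdge K S (v i) (v j)
    proper {i} {j} adj with i Fin.≟ j
    ... | yes i≡j = inj₁ i≡j
    ... | no  i≢j = inj₂ (i≢j ∘ v-injective , adj)

-- Normal forms in the free product

module NormalForm (G : Group c₁ ℓ₁) (H : Group c₂ ℓ₂) where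
  private
    module G = Group G
    module H = Group H
  open FreeProduct G H renaming (cong to ≋-cong)

  colour : Letter → Bool
  colour (inj₁ _) = true
  colour (inj₂ _) = false

  data Trivial : Letter → Set (c₁ ⊔ˡ c₂ ⊔ˡ ℓ₁ ⊔ˡ ℓ₂) where
    triv-G : ∀ {x} → x G.≈ G.ε → Trivial (inj₁ x)
    triv-H : ∀ {x} → x H.≈ H.ε → Trivial (inj₂ x)

  infix 4 _≈ᴸ_
  data _≈ᴸ_ : Letter → Letter → Set (c₁ ⊔ˡ c₂ ⊔ˡ ℓ₁ ⊔ˡ ℓ₂) where
    ≈-G : ∀ {x y} → x G.≈ y → inj₁ x ≈ᴸ inj₁ y
    ≈-H : ∀ {x y} → x H.≈ y → inj₂ x ≈ᴸ inj₂ y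

  -- Meaningful only for letters of the same colour.
  infixl 7 _·_
  _·_ : Letter → Letter → Letter
  inj₁ x · inj₁ y = inj₁ (x G.∙ y)
  inj₂ x · inj₂ y = inj₂ (x H.∙ y)
  inj₁ x · inj₂ y = inj₁ x
  inj₂ x · inj₁ y = inj₂ x

  1ᴸ : Bool → Letter
  1ᴸ true  = inj₁ G.ε
  1ᴸ false = inj₂ H.ε

  1ᴸ-colour : ∀ b → colour (1ᴸ b) ≡ b
  1ᴸ-colour true  = ≡.refl
  1ᴸ-colour false = ≡.refl

  1ᴸ-trivial : ∀ b → Trivial (1ᴸ b)
  1ᴸ-trivial true  = triv-G G.refl
  1ᴸ-trivial false = triv-H H.refl

  ≈ᴸ-refl : ∀ {x} → x ≈ᴸ x
  ≈ᴸ-refl {inj₁ x} = ≈-G G.refl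
  ≈ᴸ-refl {inj₂ x} = ≈-H H.refl

  ≈ᴸ-sym : ∀ {x y} → x ≈ᴸ y → y ≈ᴸ x
  ≈ᴸ-sym (≈-G p) = ≈-G (G.sym p)
  ≈ᴸ-sym (≈-H p) = ≈-H (H.sym p)

  ≈ᴸ-trans : ∀ {x y z} → x ≈ᴸ y → y ≈ᴸ z → x ≈ᴸ z
  ≈ᴸ-trans (≈-G p) (≈-G q) = ≈-G (G.trans p q)
  ≈ᴸ-trans (≈-H p) (≈-H q) = ≈-H (H.trans p q)

  ≈ᴸ-colour : ∀ {x y} → x ≈ᴸ y → colour x ≡ colour y
  ≈ᴸ-colour (≈-G _) = ≡.refl
  ≈ᴸ-colour (≈-H _) = ≡.refl

  ·-colour : ∀ x y → colour (x · y) ≡ colour x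
  ·-colour (inj₁ _) (inj₁ _) = ≡.refl
  ·-colour (inj₁ _) (inj₂ _) = ≡.refl
  ·-colour (inj₂ _) (inj₁ _) = ≡.refl
  ·-colour (inj₂ _) (inj₂ _) = ≡.refl

  ·-cong : ∀ {x x′ y y′} → x ≈ᴸ x′ → y ≈ᴸ y′ → x · y ≈ᴸ x′ · y′
  ·-cong (≈-G p) (≈-G q) = ≈-G (G.∙-cong p q)
  ·-cong (≈-H p) (≈-H q) = ≈-H (H.∙-cong p q)
  ·-cong (≈-G p) (≈-H q) = ≈-G p
  ·-cong (≈-H p) (≈-G q) = ≈-H p

  ·-identityˡ : ∀ x → 1ᴸ (colour x) · x ≈ᴸ x
  ·-identityˡ (inj₁ x) = ≈-G (G.identityˡ x)
  ·-identityˡ (inj₂ x) = ≈-H (H.identityˡ x)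

  ·-identityʳ : ∀ x {y} → Trivial y → x · y ≈ᴸ x
  ·-identityʳ (inj₁ x) (triv-G p) = ≈-G (G.trans (G.∙-congˡ p) (G.identityʳ x))
  ·-identityʳ (inj₂ x) (triv-H p) = ≈-H (H.trans (H.∙-congˡ p) (H.identityʳ x))
  ·-identityʳ (inj₁ x) (triv-H p) = ≈ᴸ-refl
  ·-identityʳ (inj₂ x) (triv-G p) = ≈ᴸ-refl

  ·-assoc : ∀ x {y z} → colour y ≡ colour z → x · y · z ≈ᴸ x · (y · z)
  ·-assoc (inj₁ x) {inj₁ y} {inj₁ z} _ = ≈-G (G.assoc x y z)
  ·-assoc (inj₂ x) {inj₂ y} {inj₂ z} _ = ≈-H (H.assoc x y z)
  ·-assoc (inj₁ x) {inj₂ y} {inj₂ z} _ = ≈ᴸ-refl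
  ·-assoc (inj₂ x) {inj₁ y} {inj₁ z} _ = ≈ᴸ-refl

  Trivial-≈ : ∀ {x y} → x ≈ᴸ y → Trivial x → Trivial y
  Trivial-≈ (≈-G p) (triv-G q) = triv-G (G.trans (G.sym p) q)
  Trivial-≈ (≈-H p) (triv-H q) = triv-H (H.trans (H.sym p) q)

  Trivial-unique : ∀ {x y} → colour x ≡ colour y → Trivial x → Trivial y → x ≈ᴸ y
  Trivial-unique _ (triv-G p) (triv-G q) = ≈-G (G.trans p (G.sym q))
  Trivial-unique _ (triv-H p) (triv-H q) = ≈-H (H.trans p (H.sym q))

  ≋-reflexive : ∀ {u v} → u ≡ v → u ≋ v
  ≋-reflexive ≡.refl = refl

  letter-≋ : ∀ {x y} → x ≈ᴸ y → [ x ] ≋ [ y ]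
  letter-≋ (≈-G p) = ≈-G p
  letter-≋ (≈-H p) = ≈-H p

  trivial-≋ : ∀ {x} → Trivial x → [ x ] ≋ []
  trivial-≋ (triv-G p) = trans (≈-G p) ε-G
  trivial-≋ (triv-H p) = trans (≈-H p) ε-H

  ·-≋ : ∀ {x y} → colour x ≡ colour y → x ∷ y ∷ [] ≋ [ x · y ]
  ·-≋ {inj₁ x} {inj₁ y} _ = ∙-G x y
  ·-≋ {inj₂ x} {inj₂ y} _ = ∙-H x y

  -- A stack is a word read backwards, so that multiplication on the right acts
  -- on its head.
  Stack : Set (c₁ ⊔ˡ c₂)
  Stack = List Letter

  ⟪_⟫ : Stack → Word
  ⟪ [] ⟫    = []
  ⟪ x ∷ s ⟫ = ⟪ s ⟫ ∷ʳ x

  infix 4 _≈*_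
  _≈*_ : Stack → Stack → Set (c₁ ⊔ˡ c₂ ⊔ˡ ℓ₁ ⊔ˡ ℓ₂)
  _≈*_ = Pointwise _≈ᴸ_

  ≈*-refl : ∀ {s} → s ≈* s
  ≈*-refl = Pointwise.refl ≈ᴸ-refl

  ≈*-sym : ∀ {s t} → s ≈* t → t ≈* s
  ≈*-sym = Pointwise.symmetric ≈ᴸ-sym

  ≈*-trans : ∀ {s t u} → s ≈* t → t ≈* u → s ≈* u
  ≈*-trans = Pointwise.transitive ≈ᴸ-trans

  data Fresh (b : Bool) : Stack → Set (c₁ ⊔ˡ c₂) where
    []  : Fresh b []
    top : ∀ {x s} → colour x ≢ b → Fresh b (x ∷ s)

  data Reduced : Stack → Set (c₁ ⊔ˡ c₂ ⊔ˡ ℓ₁ ⊔ˡ ℓ₂) where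
    []   : Reduced []
    cons : ∀ {x s} → ¬ Trivial x → Fresh (colour x) s → Reduced s → Reduced (x ∷ s)

  -- View s g t: t is the reduced form of the product of s with a possibly
  -- trivial letter g, whose colour is not that of the top of s.  In these
  -- coordinates a letter of the colour of g acts by multiplying g, so the
  -- action of a factor needs no case distinctions.
  data View (s : Stack) (g : Letter) : Stack → Set (c₁ ⊔ˡ c₂ ⊔ˡ ℓ₁ ⊔ˡ ℓ₂) where
    absent  : Trivial g → View s g s
    present : ∀ {g′} → ¬ Trivial g → g ≈ᴸ g′ → View s g (g′ ∷ s)

  Base : Bool → Stack → Set (c₁ ⊔ˡ c₂ ⊔ˡ ℓ₁ ⊔ˡ ℓ₂)
  Base b s = Fresh b s × Reduced s

  View-reduced : ∀ {s g t} → Base (colour g) s → View s g t → Reduced t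
  View-reduced (f , r) (absent _)      = r
  View-reduced (f , r) (present ¬tg g≈) = cons (λ t → ¬tg (Trivial-≈ (≈ᴸ-sym g≈) t))
    (subst (λ b → Fresh b _) (≈ᴸ-colour g≈) f) r

  View-functional : ∀ {s g t s′ g′ t′} → View s g t → View s′ g′ t′ → s ≈* s′ → g ≈ᴸ g′ → t ≈* t′
  View-functional (absent _) (absent _) s≈ g≈ = s≈
  View-functional (absent tg) (present ¬tg′ _) s≈ g≈ = ⊥-elim (¬tg′ (Trivial-≈ g≈ tg))
  View-functional (present ¬tg _) (absent tg′) s≈ g≈ = ⊥-elim (¬tg (Trivial-≈ (≈ᴸ-sym g≈) tg′))
  View-functional (present _ p) (present _ q) s≈ g≈ = ≈ᴸ-trans (≈ᴸ-sym p) (≈ᴸ-trans g≈ q) ∷ s≈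

  Fresh-clash : ∀ {b x s t} → Fresh b t → colour x ≡ b → t ≈* x ∷ s → ⊥
  Fresh-clash (top ne) eq (y≈x ∷ _) = ne (≡.trans (≈ᴸ-colour y≈x) eq)

  -- If a letter were absent from one view and present in the other, the top of the stack would have
  -- the colour that freshness forbids there.
  View-injective : ∀ {s g t s′ g′ t′} → Fresh (colour g) s → Fresh (colour g′) s′ → colour g ≡ colour g′ →
    View s g t → View s′ g′ t′ → t ≈* t′ → s ≈* s′ × g ≈ᴸ g′
  View-injective f f′ eq (absent tg) (absent tg′) t≈ = t≈ , Trivial-unique eq tg tg′
  View-injective f f′ eq (absent _) (present _ p) t≈ =
    ⊥-elim (Fresh-clash f (≡.trans (≡.sym (≈ᴸ-colour p)) (≡.sym eq)) t≈)
  View-injective f f′ eq (present _ p) (absent _) t≈ =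
    ⊥-elim (Fresh-clash f′ (≡.trans (≡.sym (≈ᴸ-colour p)) eq) (≈*-sym t≈))
  View-injective f f′ eq (present _ p) (present _ q) (h ∷ t≈) =
    t≈ , ≈ᴸ-trans p (≈ᴸ-trans h (≈ᴸ-sym q))

  View-total : ∀ s g → ¬ ¬ ∃ λ t → View s g t
  View-total s g = do
    trivial? ← em (Trivial g)
    return (decide trivial?)
    where
    decide : Dec (Trivial g) → ∃ λ t → View s g t
    decide (yes tg) = s , absent tg
    decide (no ¬tg) = g ∷ s , present ¬tg ≈ᴸ-refl

  view : ∀ b {t} → Reduced t → ∃ λ s → ∃ λ g → colour g ≡ b × Base b s × View s g t
  view b [] = [] , 1ᴸ b , 1ᴸ-colour b , ([] , []) , absent (1ᴸ-trivial b)
  view b (cons {x} {s} ¬tx f r) with colour x Bool.≟ b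
  ... | yes ≡.refl = s , x , ≡.refl , (f , r) , present ¬tx ≈ᴸ-refl
  ... | no ne = x ∷ s , 1ᴸ b , 1ᴸ-colour b , (top ne , cons ¬tx f r) , absent (1ᴸ-trivial b)

  View-≋ : ∀ {s g t} → View s g t → ⟪ t ⟫ ≋ ⟪ s ⟫ ∷ʳ g
  View-≋ {s} (absent tg) = trans (≋-reflexive (≡.sym (++-identityʳ ⟪ s ⟫))) (≋-cong (refl {⟪ s ⟫}) (sym (trivial-≋ tg)))
  View-≋ {s} (present _ g≈) = ≋-cong (refl {⟪ s ⟫}) (sym (letter-≋ g≈))

  -- Computing the result would require deciding triviality. As a relation it is functional up to
  -- `_≈*_`, and total under a double negation.
  Push : Stack → Letter → Stack → Set (c₁ ⊔ˡ c₂ ⊔ˡ ℓ₁ ⊔ˡ ℓ₂)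
  Push t x t′ = ∃ λ s → ∃ λ g → colour g ≡ colour x × Base (colour g) s × View s g t × View s (g · x) t′

  data Run : Stack → Word → Stack → Set (c₁ ⊔ˡ c₂ ⊔ˡ ℓ₁ ⊔ˡ ℓ₂) where
    []  : ∀ {t} → Run t [] t
    _∷_ : ∀ {t x t′ u t″} → Push t x t′ → Run t′ u t″ → Run t (x ∷ u) t″

  Push-reduced : ∀ {t x t′} → Push t x t′ → Reduced t′
  Push-reduced {x = x} (s , g , eq , base , _ , out) =
    View-reduced (subst (λ b → Base b s) (≡.sym (·-colour g x)) base) out

  Push-functional : ∀ {t x t₁ t′ x′ t₁′} → t ≈* t′ → x ≈ᴸ x′ → Push t x t₁ → Push t′ x′ t₁′ → t₁ ≈* t₁′
  Push-functional t≈ x≈ (s , g , eq , (f , _) , vin , vout) (s′ , g′ , eq′ , (f′ , _) , vin′ , vout′) =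
    let s≈ , g≈ = View-injective f f′ (≡.trans eq (≡.trans (≈ᴸ-colour x≈) (≡.sym eq′))) vin vin′ t≈ in
    View-functional vout vout′ s≈ (·-cong g≈ x≈)

  Push-total : ∀ {t} x → Reduced t → ¬ ¬ ∃ λ t′ → Push t x t′
  Push-total x r = do
    let s , g , eq , base , vin = view (colour x) r
    t′ , vout ← View-total s (g · x)
    return (t′ , s , g , eq , subst (λ b → Base b s) (≡.sym eq) base , vin , vout)

  Push-≋ : ∀ {t x t′} → Push t x t′ → ⟪ t′ ⟫ ≋ ⟪ t ⟫ ∷ʳ x
  Push-≋ {t} {x} (s , g , eq , _ , vin , vout) =
    trans (View-≋ vout)
    (trans (≋-cong (refl {⟪ s ⟫}) (sym (·-≋ eq)))
    (trans (≋-reflexive (≡.sym (++-assoc ⟪ s ⟫ [ g ] [ x ])))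
           (≋-cong (sym (View-≋ vin)) refl)))

  Run-reduced : ∀ {t u t′} → Reduced t → Run t u t′ → Reduced t′
  Run-reduced r []       = r
  Run-reduced r (p ∷ run) = Run-reduced (Push-reduced p) run

  Run-total : ∀ {t} u → Reduced t → ¬ ¬ ∃ λ t′ → Run t u t′
  Run-total []      r = return (_ , [])
  Run-total (x ∷ u) r = do
    t′ , p ← Push-total x r
    t″ , run ← Run-total u (Push-reduced p)
    return (t″ , p ∷ run)

  Run-≋ : ∀ {t u t′} → Run t u t′ → ⟪ t′ ⟫ ≋ ⟪ t ⟫ ++ u
  Run-≋ {t} []  = ≋-reflexive (≡.sym (++-identityʳ ⟪ t ⟫))
  Run-≋ {t} (_∷_ {x = x} {u = u} p run) = trans (Run-≋ run)
    (trans (≋-cong (Push-≋ p) refl) (≋-reflexive (++-assoc ⟪ t ⟫ [ x ] u)))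

  Run-++ : ∀ {t t′ t″} u {v} → Run t u t′ → Run t′ v t″ → Run t (u ++ v) t″
  Run-++ []      []        run = run
  Run-++ (x ∷ u) (p ∷ r) run = p ∷ Run-++ u r run

  Run-split : ∀ {t t″} u {v} → Run t (u ++ v) t″ → ∃ λ t′ → Run t u t′ × Run t′ v t″
  Run-split []      run = _ , [] , run
  Run-split (x ∷ u) (p ∷ run) = let t′ , r , r′ = Run-split u run in t′ , p ∷ r , r′

  Run-functional : ∀ {t t′ s s′} u → t ≈* s → Run t u t′ → Run s u s′ → t′ ≈* s′
  Run-functional []      t≈ []        []         = t≈
  Run-functional (x ∷ u) t≈ (p ∷ r) (p′ ∷ r′) =
    Run-functional u (Push-functional t≈ ≈ᴸ-refl p p′) r r′

  Push-trivial : ∀ {t x t′} → Trivial x → Push t x t′ → t ≈* t′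
  Push-trivial tx (s , g , eq , base , vin , vout) =
    View-functional vin vout ≈*-refl (≈ᴸ-sym (·-identityʳ g tx))

  -- The coordinates in which the second letter acts agree with those left by the first one, so the
  -- claim reduces to associativity in one factor.
  Push-· : ∀ {t s x y t₁ t₂ s₁} → colour x ≡ colour y → t ≈* s →
    Push t x t₁ → Push t₁ y t₂ → Push s (x · y) s₁ → t₂ ≈* s₁
  Push-· {x = x} {y} eqxy t≈
    (a , g , eg , (fa , ra) , vin , vout) (b , h , eh , (fb , _) , vin′ , vout′) (e , k , ek , (fe , _) , vin″ , vout″) =
    let b≈ , h≈ = View-injective (subst (λ z → Fresh z a) (≡.sym (·-colour g x)) fa) fb
                    (≡.trans (·-colour g x) (≡.trans eg (≡.trans eqxy (≡.sym eh)))) vout vin′ ≈*-refl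
        e≈ , k≈ = View-injective fa fe (≡.trans eg (≡.trans (≡.sym (·-colour x y)) (≡.sym ek))) vin vin″ t≈
    in View-functional vout′ vout″ (≈*-trans (≈*-sym b≈) e≈)
         (≈ᴸ-trans (·-cong (≈ᴸ-sym h≈) ≈ᴸ-refl) (≈ᴸ-trans (·-assoc g eqxy) (·-cong k≈ ≈ᴸ-refl)))

  -- Van der Waerden's argument: words act on reduced stacks, and the action respects each defining
  -- relation of `_≋_`. In the case of transitivity the intermediate word has to be run as well,
  -- which is why `Run-total` is needed.
  Run-invariant : ∀ {u v} → u ≋ v → ∀ {t s t′ s′} → Reduced t → Reduced s → t ≈* s →
    Run t u t′ → Run s v s′ → ¬ ¬ t′ ≈* s′
  Run-invariant {u} refl rt rs t≈ r r′ = return (Run-functional u t≈ r r′)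
  Run-invariant (sym h) rt rs t≈ r r′ = do
    eq ← Run-invariant h rs rt (≈*-sym t≈) r′ r
    return (≈*-sym eq)
  Run-invariant (trans {v = w} h h′) rt rs t≈ r r′ = do
    _ , r″ ← Run-total w rt
    eq ← Run-invariant h rt rt ≈*-refl r r″
    eq′ ← Run-invariant h′ rt rs t≈ r″ r′
    return (≈*-trans eq eq′)
  Run-invariant (≋-cong {u} {u′} h h′) rt rs t≈ r r′ = do
    let _ , r₁ , r₂ = Run-split u r
        _ , r₁′ , r₂′ = Run-split u′ r′
    eq ← Run-invariant h rt rs t≈ r₁ r₁′
    Run-invariant h′ (Run-reduced rt r₁) (Run-reduced rs r₁′) eq r₂ r₂′
  Run-invariant (≈-G p) rt rs t≈ (q ∷ []) (q′ ∷ []) = return (Push-functional t≈ (≈-G p) q q′)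
  Run-invariant (≈-H p) rt rs t≈ (q ∷ []) (q′ ∷ []) = return (Push-functional t≈ (≈-H p) q q′)
  Run-invariant ε-G rt rs t≈ (q ∷ []) [] = return (≈*-trans (≈*-sym (Push-trivial (triv-G G.refl) q)) t≈)
  Run-invariant ε-H rt rs t≈ (q ∷ []) [] = return (≈*-trans (≈*-sym (Push-trivial (triv-H H.refl) q)) t≈)
  Run-invariant (∙-G x y) rt rs t≈ (q ∷ q′ ∷ []) (q″ ∷ []) = return (Push-· ≡.refl t≈ q q′ q″)
  Run-invariant (∙-H x y) rt rs t≈ (q ∷ q′ ∷ []) (q″ ∷ []) = return (Push-· ≡.refl t≈ q q′ q″)

  Run-reduced-word : ∀ {t} → Reduced t → Run [] ⟪ t ⟫ t
  Run-reduced-word [] = []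
  Run-reduced-word (cons {x} {s} ¬tx f r) = Run-++ ⟪ s ⟫ (Run-reduced-word r)
    -- The next letter meets a top of the other colour, so in coordinates it multiplies the trivial
    -- letter.
    ((s , 1ᴸ (colour x) , 1ᴸ-colour (colour x)
        , subst (λ b → Base b s) (≡.sym (1ᴸ-colour (colour x))) (f , r)
        , absent (1ᴸ-trivial (colour x))
        , present (λ t → ¬tx (Trivial-≈ (·-identityˡ x) t)) (·-identityˡ x)) ∷ [])

  -- The length is the depth in the tree of cosets. As equality of numbers is decidable, the double
  -- negation disappears.
  reduced-length : ∀ {s t} → Reduced s → Reduced t → ⟪ s ⟫ ≋ ⟪ t ⟫ → List.length s ≡ List.length t
  reduced-length rs rt h = decidable-stable (_ ≟ _) (do
    s≈t ← Run-invariant h [] [] [] (Run-reduced-word rs) (Run-reduced-word rt)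
    return (Pointwise.Pointwise-length s≈t))

  normal-form : ∀ u → ¬ ¬ ∃ λ t → Reduced t × u ≋ ⟪ t ⟫
  normal-form u = do
    t , run ← Run-total u []
    return (t , Run-reduced [] run , sym (Run-≋ run))

-- Cutting off the lighter side at a vertex

∧-false : ∀ {x y} → x ≡ true → x ∧ y ≡ false → y ≡ false
∧-false ≡.refl h = h

-- At most one vertex X of the kept part is adjacent to the rest of Y; the weight
-- of the rest is moved to that vertex.
hang : {E : Fin n → Fin n → Set p} → (∀ {i j} → E i j → E j i) → (Y keep X : Sets n) (w : Fin n → ℕ) {b : ℕ} →
  (∀ {i j} → E i j → Y i ≡ true → Y j ≡ true → keep i ≡ true → keep j ≡ false → X i ≡ true) →
  (∀ i j → X i ≡ true → X j ≡ true → i ≡ j) →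
  2 * wt w (λ i → Y i ∧ not (keep i)) ≤ wt w Y →
  (∀ w′ → ¬ ¬ Sep E (λ i → Y i ∧ keep i) w′ b) → ¬ ¬ Sep E Y w b
hang {n} {E = E} E-sym Y keep X w {b} bridge X-unique R-light separate = do
  S′ , c′ , S′≤b , consistent , light ← separate w′
  attached? ← em (∃ λ x → K x ≡ true × S′ x ≡ false × X x ≡ true)
  return (reattach S′ c′ S′≤b consistent light attached?)
  where
  K R : Sets n
  K i = Y i ∧ keep i
  R i = Y i ∧ not (keep i)
  r : ℕ
  r = wt w R
  w′ : Fin n → ℕ
  w′ i = w i + ⟦ X i ⟧ * r

  wt-w′ : ∀ Z → wt w′ Z ≡ wt w Z + card (λ i → Z i ∧ X i) * r
  wt-w′ Z = begin
    sum (λ i → ⟦ Z i ⟧ * (w i + ⟦ X i ⟧ * r))                     ≡⟨ sum-cong-≗ (λ i → pointwise (Z i) (X i) (w i)) ⟩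
    sum (λ i → ⟦ Z i ⟧ * w i + ⟦ Z i ∧ X i ⟧ * 1 * r)             ≡⟨ ∑-distrib-+ (λ i → ⟦ Z i ⟧ * w i) (λ i → ⟦ Z i ∧ X i ⟧ * 1 * r) ⟩
    wt w Z + sum (λ i → ⟦ Z i ∧ X i ⟧ * 1 * r)                    ≡⟨ cong (wt w Z +_) (*-distribʳ-sum r (λ i → ⟦ Z i ∧ X i ⟧ * 1)) ⟨
    wt w Z + card (λ i → Z i ∧ X i) * r                           ∎
    where
    open ≡-Reasoning
    pointwise : ∀ z x w → ⟦ z ⟧ * (w + ⟦ x ⟧ * r) ≡ ⟦ z ⟧ * w + ⟦ z ∧ x ⟧ * 1 * r
    pointwise false x w = ≡.refl
    pointwise true  x w = lem w ⟦ x ⟧ r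
      where
      lem : ∀ w x r → w + x * r + 0 ≡ w + 0 + x * 1 * r
      lem = solve-∀

  -- Not an equation, since the kept part may contain no vertex of `X`; the weight of the rest is
  -- then dropped.
  total : wt w′ K ≤ wt w Y
  total = begin
    wt w′ K                                ≡⟨ wt-w′ K ⟩
    wt w K + card (λ i → K i ∧ X i) * r    ≤⟨ +-monoʳ-≤ (wt w K) (*-monoˡ-≤ r (card-unique (λ i → K i ∧ X i)
                                                λ i j hi hj → X-unique i j (∧-conicalʳ (K i) _ hi) (∧-conicalʳ (K j) _ hj))) ⟩
    wt w K + 1 * r                         ≡⟨ cong (wt w K +_) (*-identityˡ r) ⟩
    wt w K + r                             ≤⟨ wt-+-≤ w K R Y (λ i → bool₂ (λ y k → ⟦ y ∧ k ⟧ + ⟦ y ∧ not k ⟧) (λ y k → ⟦ y ⟧) (Y i) (keep i)) ⟩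
    wt w Y                                 ∎
    where open ≤-Reasoning

  module _ (S′ : Sets n) (c′ : Fin n → ℕ) (S′≤b : card S′ ≤ b)
    (consistent : ∀ {i j} → E i j → K i ≡ true → K j ≡ true → S′ i ≡ false → S′ j ≡ false → c′ i ≡ c′ j)
    (light : ∀ k → 2 * wt w′ (cls K S′ c′ k) ≤ wt w′ K) where

    -- `ρ` is the label of the rest. It is the label of the attaching vertex if that vertex is kept
    -- and avoids `S′`; otherwise the rest is cut off and gets the label 0, which no kept vertex
    -- has.
    module _ (ρ : ℕ)
      (ρ-attached : ∀ {k} → ρ ≡ suc k → ∃ λ x → cls K S′ c′ k x ≡ true × X x ≡ true)
      (attached-ρ : ∀ i → K i ≡ true → S′ i ≡ false → X i ≡ true → ρ ≡ suc (c′ i)) where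

      S : Sets n
      S i = keep i ∧ S′ i
      c : Fin n → ℕ
      c i = if keep i then suc (c′ i) else ρ

      c-keep : ∀ {i} → keep i ≡ true → c i ≡ suc (c′ i)
      c-keep {i} h = cong (λ b → if b then suc (c′ i) else ρ) h

      c-rest : ∀ {i} → keep i ≡ false → c i ≡ ρ
      c-rest {i} h = cong (λ b → if b then suc (c′ i) else ρ) h

      across : ∀ {i j} → E i j → Y i ≡ true → Y j ≡ true → S i ≡ false → keep i ≡ true → keep j ≡ false → c i ≡ c j
      across {i} Eij Yi Yj Si ki kj = ≡.trans (c-keep ki) (≡.trans
        (≡.sym (attached-ρ i (∧-true Yi ki) (∧-false ki Si) (bridge Eij Yi Yj ki kj))) (≡.sym (c-rest kj)))

      consistent′ : ∀ {i j} → E i j → Y i ≡ true → Y j ≡ true → S i ≡ false → S j ≡ false → c i ≡ c j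
      consistent′ {i} {j} Eij Yi Yj Si Sj with true? (keep i) | true? (keep j)
      ... | inj₁ ki | inj₁ kj = ≡.trans (c-keep ki) (≡.trans
              (cong suc (consistent Eij (∧-true Yi ki) (∧-true Yj kj) (∧-false ki Si) (∧-false kj Sj))) (≡.sym (c-keep kj)))
      ... | inj₁ ki | inj₂ kj = across Eij Yi Yj Si ki kj
      ... | inj₂ ki | inj₁ kj = ≡.sym (across (E-sym Eij) Yj Yi Sj kj ki)
      ... | inj₂ ki | inj₂ kj = ≡.trans (c-rest ki) (≡.sym (c-rest kj))

      class-keep : ∀ {k i} → keep i ≡ true → cls Y S c (suc k) i ≡ true → cls K S′ c′ k i ≡ true
      class-keep {k} {i} ki h with cls-elim Y S c {suc k} {i} h
      ... | Yi , Si , ci = cls-true K S′ c′ (∧-true Yi ki) (∧-false ki Si) (suc-injective (≡.trans (≡.sym (c-keep ki)) ci))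

      class-bound : ∀ k → wt w (cls Y S c (suc k)) ≤ wt w′ (cls K S′ c′ k)
      class-bound k with ρ ≟ suc k
      ... | no ρ≢ = ≤-trans (wt-mono w (cls Y S c (suc k)) (cls K S′ c′ k) sub)
                            (≤-trans (m≤m+n _ _) (≤-reflexive (≡.sym (wt-w′ (cls K S′ c′ k)))))
        where
        sub : ∀ i → cls Y S c (suc k) i ≡ true → cls K S′ c′ k i ≡ true
        sub i h with true? (keep i)
        ... | inj₁ ki = class-keep ki h
        ... | inj₂ ki = ⊥-elim (ρ≢ (≡.trans (≡.sym (c-rest ki)) (proj₂ (proj₂ (cls-elim Y S c {suc k} {i} h)))))
      ... | yes ρ≡ with ρ-attached ρ≡
      ...   | x , Kx , Xx = begin
        wt w (cls Y S c (suc k))           ≤⟨ wt-≤-+ w (cls Y S c (suc k)) (cls K S′ c′ k) R cover ⟩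
        wt w (cls K S′ c′ k) + r           ≡⟨ cong (wt w (cls K S′ c′ k) +_) (*-identityˡ r) ⟨
        wt w (cls K S′ c′ k) + 1 * r       ≤⟨ +-monoʳ-≤ (wt w (cls K S′ c′ k)) (*-monoˡ-≤ r
                                                (≤-trans (≤-reflexive (cong (λ b → ⟦ b ⟧ * 1) (≡.sym (∧-true Kx Xx))))
                                                         (term≤sum (λ i → ⟦ cls K S′ c′ k i ∧ X i ⟧ * 1) x))) ⟩
        wt w (cls K S′ c′ k) + card (λ i → cls K S′ c′ k i ∧ X i) * r ≡⟨ wt-w′ (cls K S′ c′ k) ⟨
        wt w′ (cls K S′ c′ k)              ∎
        where
        open ≤-Reasoning
        cover : ∀ i → ⟦ cls Y S c (suc k) i ⟧ ≤ ⟦ cls K S′ c′ k i ⟧ + ⟦ R i ⟧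
        cover i with true? (keep i)
        ... | inj₁ ki = ≤-trans (⟦⟧-mono {cls Y S c (suc k) i} {cls K S′ c′ k i} (class-keep ki)) (m≤m+n _ _)
        ... | inj₂ ki = ≤-trans (⟦⟧-mono {cls Y S c (suc k) i} {R i} λ h →
                ∧-true (proj₁ (cls-elim Y S c {suc k} {i} h)) (not-true ki)) (m≤n+m _ ⟦ cls K S′ c′ k i ⟧)

      light′ : ∀ k → 2 * wt w (cls Y S c k) ≤ wt w Y
      -- Labels of kept vertices are shifted by one, so this class lies in the rest.
      light′ zero = ≤-trans (*-monoʳ-≤ 2 (wt-mono w (cls Y S c 0) R sub)) R-light
        where
        sub : ∀ i → cls Y S c 0 i ≡ true → R i ≡ true
        sub i h with cls-elim Y S c {0} {i} h | true? (keep i)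
        ... | Yi , _ , ci | inj₁ ki = ⊥-elim (0≢1+n (≡.trans (≡.sym ci) (c-keep ki)))
        ... | Yi , _ , ci | inj₂ ki = ∧-true Yi (not-true ki)
      light′ (suc k) = ≤-trans (*-monoʳ-≤ 2 (class-bound k)) (≤-trans (light k) total)

      reattach-at : Sep E Y w b
      reattach-at = S , c , ≤-trans (wt-mono (const 1) S S′ λ i → ∧-conicalʳ (keep i) _) S′≤b
                  , consistent′ , light′

    reattach : Dec (∃ λ x → K x ≡ true × S′ x ≡ false × X x ≡ true) → Sep E Y w b
    reattach (yes (x , Kx , Sx , Xx)) = reattach-at (suc (c′ x))
      (λ eq → x , cls-true K S′ c′ Kx Sx (suc-injective eq) , Xx)
      (λ i _ _ Xi → cong (suc ∘ c′) (X-unique x i Xx Xi))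
    reattach (no none) = reattach-at 0 (λ ()) (λ i Ki Si Xi → ⊥-elim (none (i , Ki , Si , Xi)))

-- A factor of a free product is a retract, and the retraction kills the
-- generators of the other factor.
module _ (F : Group c₁ ℓ₁) (K : Group c₂ ℓ₂) where
  private
    module F = Group F
    module K = Group K
  open GroupMorphisms F.rawGroup K.rawGroup using (IsGroupHomomorphism)
  open MagmaMorphisms K.rawMagma F.rawMagma using (IsMagmaHomomorphism)

  coset-separated : ∀ {J I : Set} {s : J → F.Carrier} {z : I → K.Carrier}
    {ι : F.Carrier → K.Carrier} {ρ : K.Carrier → F.Carrier} →
    IsGroupHomomorphism ι → IsMagmaHomomorphism ρ → (∀ g → ρ (ι g) F.≈ g) →
    (∀ i → (∃ λ j → ρ (z i) F.≈ s j) ⊎ ρ (z i) F.≈ F.ε) →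
    ∀ {N b} → Adjacency.Separated F s N b →
    n ≤ N → (v : Fin n → K.Carrier) → Injective _≡_ K._≈_ v → ∀ x (Y : Sets n) →
    (∀ i → Y i ≡ true → ∃ λ g → v i K.≈ x K.∙ ι g) →
    ∀ w → ¬ ¬ Sep (λ i j → Adjacency.Adj K z (v i) (v j)) Y w b
  coset-separated {s = s} {z} {ι} {ρ} ι-hom ρ-hom ρι ρz {b = b} separated n≤N v v-injective x Y in-coset w = do
    sep ← separated (≤-trans (≤-reflexive (card-size En)) (≤-trans (card≤n Y) n≤N)) g g-injective (w ∘ elem)
    return (Sep-reindex En (Sep-mono ≤-refl adjacent sep))
    where
    module ι = IsGroupHomomorphism ι-hom
    module ρ = IsMagmaHomomorphism ρ-hom
    En = enumerate Y
    open Enumeration En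
    g : Fin size → F.Carrier
    g i = proj₁ (in-coset (elem i) (sound i))
    v≈ : ∀ i → v (elem i) K.≈ x K.∙ ι (g i)
    v≈ i = proj₂ (in-coset (elem i) (sound i))
    g-injective : Injective _≡_ F._≈_ g
    g-injective {i} {j} h = injective (v-injective
      (K.trans (v≈ i) (K.trans (K.∙-congˡ (ι.⟦⟧-cong h)) (K.sym (v≈ j)))))
    -- The coset representative `x` cancels on the left, and `ρ` carries what remains into `F`.
    project : ∀ {i j r} → v (elem j) K.≈ v (elem i) K.∙ z r → g j F.≈ g i F.∙ ρ (z r)
    project {i} {j} {r} h = F.trans (F.sym (ρι (g j))) (F.trans (ρ.⟦⟧-cong (GroupProperties.∙-cancelˡ K x _ _
        (K.trans (K.sym (v≈ j)) (K.trans h (K.trans (K.∙-congʳ (v≈ i)) (K.assoc _ _ _))))))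
      (F.trans (ρ.homo _ _) (F.∙-congʳ (ρι (g i)))))
    adjacent : ∀ {i j} → Adjacency.Adj K z (v (elem i)) (v (elem j)) → i ≡ j ⊎ Adjacency.Adj F s (g i) (g j)
    adjacent {i} {j} (r , inj₁ h) with ρz r
    ... | inj₁ (l , eq) = inj₂ (l , inj₁ (F.trans (project h) (F.∙-congˡ eq)))
    -- A generator of the other factor becomes trivial in `F`, so inside one coset it can only label
    -- a loop.
    ... | inj₂ eq       = inj₁ (≡.sym (g-injective (F.trans (project h) (F.trans (F.∙-congˡ eq) (F.identityʳ _)))))
    adjacent {i} {j} (r , inj₂ h) with ρz r
    ... | inj₁ (l , eq) = inj₂ (l , inj₂ (F.trans (project h) (F.∙-congˡ eq)))
    ... | inj₂ eq       = inj₁ (g-injective (F.trans (project h) (F.trans (F.∙-congˡ eq) (F.identityʳ _))))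

-- The tree of cosets in the free product

module Tree (G : Group c₁ ℓ₁) (H : Group c₂ ℓ₂) {I : Set} (ζ : I → FreeProduct.Letter G H) where
  open FreeProduct G H using (Word; Letter; _≋_; refl; sym; trans; ε-G; invLetter)
  open NormalForm G H
  private
    module P = Group (G ✶ H)
  open Adjacency (G ✶ H) (λ i → [ ζ i ]) using (Adj; Adj-sym)

  InCoset : Bool → Word → Word → Set _
  InCoset k x u = ∃ λ l → colour l ≡ k × u ≋ x ∷ʳ l

  module _ {n b} (v : Fin n → Word) (v-injective : Injective _≡_ _≋_ v)
    (cosets : ∀ k x Y → (∀ i → Y i ≡ true → InCoset k x (v i)) →
              ∀ w → ¬ ¬ Sep (λ i j → Adj (v i) (v j)) Y w b)
    (t : Fin n → Stack) (t-reduced : ∀ i → Reduced (t i)) (v≋ : ∀ i → v i ≋ ⟪ t i ⟫) where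

    private
      E : Fin n → Fin n → Set _
      E i j = Adj (v i) (v j)

      depth : Fin n → ℕ
      depth i = List.length (t i)

      right-letter : ∀ {i j} → E i j → ∃ λ l → v j ≋ v i ∷ʳ l
      right-letter (r , inj₁ h) = ζ r , h
      right-letter {i} {j} (r , inj₂ h) = invLetter (ζ r) , sym (P.trans (P.∙-congʳ h)
        (P.trans (P.assoc (v j) [ ζ r ] [ invLetter (ζ r) ])
        (P.trans (P.∙-congˡ {v j} (P.inverseʳ [ ζ r ])) (P.identityʳ (v j)))))

    module _ (Y : Sets n) {l s} (ls-reduced : Reduced (l ∷ s))
      (deepest : ∀ j → Y j ≡ true → depth j ≤ suc (List.length s)) where

      -- A letter of the other colour would lead to a vertex deeper than l ∷ s.
      leave-coset : ∀ {i j} → E i j → Y j ≡ true → InCoset (colour l) ⟪ s ⟫ (v i) →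
                    ¬ InCoset (colour l) ⟪ s ⟫ (v j) → ¬ v i ≋ ⟪ s ⟫ → ⊥
      leave-coset {i} {j} Eij Yj (l′ , l′-colour , vi≋) j∉ i≢s with right-letter Eij
      ... | m , vj≋ with colour m Bool.≟ colour l
      ...   | yes same = j∉ (l′ · m , ≡.trans (·-colour l′ m) l′-colour ,
                trans vj≋ (trans (P.∙-congʳ vi≋) (trans (P.assoc ⟪ s ⟫ [ l′ ] [ m ])
                  (P.∙-congˡ {⟪ s ⟫} (·-≋ (≡.trans l′-colour (≡.sym same)))))))
      ...   | no other = em (Trivial m) λ
        { (yes tm) → j∉ (l′ , l′-colour , trans vj≋ (trans (P.∙-congˡ {v i} (trivial-≋ tm)) (trans (P.identityʳ (v i)) vi≋)))
        ; (no ¬tm) → em (Trivial l′) λ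
          { (yes tl) → i≢s (trans vi≋ (trans (P.∙-congˡ {⟪ s ⟫} (trivial-≋ tl)) (P.identityʳ ⟪ s ⟫)))
          ; (no ¬tl) → too-deep ¬tm ¬tl ls-reduced } }
        where
        too-deep : ¬ Trivial m → ¬ Trivial l′ → Reduced (l ∷ s) → ⊥
        too-deep ¬tm ¬tl (cons _ f r) = <⇒≱ (≤-reflexive (reduced-length
            (cons ¬tm (top λ eq → other (≡.trans (≡.sym eq) l′-colour))
              (cons ¬tl (subst (λ k → Fresh k s) (≡.sym l′-colour) f) r))
            (t-reduced j)
            (trans (sym (trans vj≋ (P.∙-congʳ vi≋))) (v≋ j))))
          (deepest j Yj)

    -- Let `l ∷ s` be the normal form of a deepest vertex `i`. Within `Y` its coset, `near`, can be
    -- left only at the element `⟪ s ⟫`, whose index, if there is one, is `X`. If the part outside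
    -- the coset is light, it is hung on `X`; otherwise the coset without `X` is light and is hung
    -- there. The first case discards some `j` outside the coset and the second one discards `i`, so
    -- `Y` shrinks.
    separate : ∀ fuel (Y : Sets n) → card Y < fuel → ∀ w → ¬ ¬ Sep E Y w b
    separate (suc fuel) Y Y<fuel w = do
      inhabited? ← em (∃ λ i → Y i ≡ true)
      by-depth inhabited?
      where
      smaller : ∀ keep v → Y v ≡ true → keep v ≡ false → ∀ w → ¬ ¬ Sep E (λ i → Y i ∧ keep i) w b
      smaller keep v Yv kv = separate fuel (λ i → Y i ∧ keep i) (≤-trans
        (card-strict (λ i → Y i ∧ keep i) Y (λ i → ∧-conicalˡ (Y i) _) v
          (≡.trans (cong (Y v ∧_) kv) (∧-zeroʳ (Y v))) Yv) (s≤s⁻¹ Y<fuel))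

      at : ∀ i → Y i ≡ true → (∀ j → Y j ≡ true → depth j ≤ depth i) →
           ∀ ti → t i ≡ ti → ¬ ¬ Sep E Y w b
      -- At depth 0 every vertex of `Y` is the identity, which lies in a coset of either colour.
      at i Yi deepest [] eq = cosets true [] Y (λ j Yj → 1ᴸ true , ≡.refl ,
        trans (v≋ j) (trans (≋-reflexive (cong ⟪_⟫ (empty (t j) (≤-trans (deepest j Yj) (≤-reflexive (cong List.length eq))))))
                            (sym ε-G))) w
        where
        empty : ∀ s → List.length s ≤ 0 → s ≡ []
        empty [] _ = ≡.refl
      at i Yi deepest (l ∷ s) eq = do
        near? ← ¬¬-∀ λ j → em (InCoset (colour l) ⟪ s ⟫ (v j))
        X? ← ¬¬-∀ λ j → em (v j ≋ ⟪ s ⟫)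
        out? ← em (∃ λ j → Y j ≡ true × does (near? j) ≡ false)
        cut near? X? out?
        where
        ls-reduced : Reduced (l ∷ s)
        ls-reduced = subst Reduced eq (t-reduced i)
        vi≋ : v i ≋ ⟪ s ⟫ ∷ʳ l
        vi≋ = trans (v≋ i) (≋-reflexive (cong ⟪_⟫ eq))
        tail-reduced : Reduced (l ∷ s) → Reduced s
        tail-reduced (cons _ _ r) = r
        module _ (near? : ∀ j → Dec (InCoset (colour l) ⟪ s ⟫ (v j))) (X? : ∀ j → Dec (v j ≋ ⟪ s ⟫)) where
          near X : Sets n
          near j = does (near? j)
          X j = does (X? j)

          does-true : ∀ {a} {B : Set a} (d : Dec B) → does d ≡ true → B
          does-true (yes b) _ = b

          does-false : ∀ {a} {B : Set a} (d : Dec B) → does d ≡ false → ¬ B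
          does-false (no ¬b) _ = ¬b

          true-does : ∀ {a} {B : Set a} (d : Dec B) → B → does d ≡ true
          true-does (yes _) _ = ≡.refl
          true-does (no ¬b) b = ⊥-elim (¬b b)

          false-does : ∀ {a} {B : Set a} (d : Dec B) → ¬ B → does d ≡ false
          false-does (yes b) ¬b = ⊥-elim (¬b b)
          false-does (no _)  _  = ≡.refl

          X-unique : ∀ j k → X j ≡ true → X k ≡ true → j ≡ k
          X-unique j k Xj Xk = v-injective (trans (does-true (X? j) Xj) (sym (does-true (X? k) Xk)))

          bridge : ∀ {j k} → E j k → Y k ≡ true → near j ≡ true → near k ≡ false → X j ≡ true
          bridge {j} {k} Ejk Yk Aj Ak with true? (X j)
          ... | inj₁ Xj = Xj
          ... | inj₂ Xj = ⊥-elim (leave-coset Y ls-reduced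
            (λ j Yj → ≤-trans (deepest j Yj) (≤-reflexive (cong List.length eq)))
            Ejk Yk (does-true (near? j) Aj) (does-false (near? k) Ak) (does-false (X? j) Xj))

          Xi : X i ≡ false
          Xi = false-does (X? i) λ h → 1+n≢n (reduced-length ls-reduced (tail-reduced ls-reduced) (trans (sym vi≋) h))

          cut : Dec (∃ λ j → Y j ≡ true × near j ≡ false) → ¬ ¬ Sep E Y w b
          cut (no none) = cosets (colour l) ⟪ s ⟫ Y (λ j Yj → near-all j Yj (true? (near j))) w
            where
            near-all : ∀ j → Y j ≡ true → near j ≡ true ⊎ near j ≡ false → InCoset (colour l) ⟪ s ⟫ (v j)
            near-all j Yj (inj₁ Aj) = does-true (near? j) Aj
            near-all j Yj (inj₂ Aj) = ⊥-elim (none (j , Yj , Aj))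
          cut (yes (j , Yj , Aj)) with 2 * wt w (λ k → Y k ∧ not (near k)) ≤? wt w Y
          ... | yes outside-light = hang Adj-sym Y near X w
            (λ Eij _ Yj Ai Aj → bridge Eij Yj Ai Aj) X-unique outside-light (smaller near j Yj Aj)
          ... | no outside-heavy = hang Adj-sym Y keep X w bridge′ X-unique coset-light
            (smaller keep i Yi (cong₂ _∨_ Xi (cong not (true-does (near? i) (l , ≡.refl , vi≋)))))
            where
            keep : Sets n
            keep k = X k ∨ not (near k)
            -- An edge between the discarded part of the coset and the outside would leave the coset
            -- at a vertex other than `X`.
            bridge′ : ∀ {j k} → E j k → Y j ≡ true → Y k ≡ true → keep j ≡ true → keep k ≡ false → X j ≡ true
            bridge′ {j} {k} Ejk Yj Yk kj kk with ∨-elim {X j} kj | ∨-false {X k} kk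
            ... | inj₁ Xj | _ = Xj
            ... | inj₂ Aj | Xk , Ak = ⊥-elim (true≢false
                    (bridge (Adj-sym Ejk) Yj (not-true⁻¹′ Ak) (not-true⁻¹ Aj)) Xk)
              where
              not-true⁻¹′ : ∀ {x} → not x ≡ false → x ≡ true
              not-true⁻¹′ {true} _ = ≡.refl
            out inside : Sets n
            out k = Y k ∧ not (near k)
            inside k = Y k ∧ not (keep k)
            coset-light : 2 * wt w inside ≤ wt w Y
            coset-light = linear (2 * wt w out)
              (≤-trans (*-monoʳ-≤ 2 (wt-+-≤ w inside out Y λ k →
                bool₃ (λ y x a → ⟦ y ∧ not (x ∨ not a) ⟧ + ⟦ y ∧ not a ⟧) (λ y x a → ⟦ y ⟧) (Y k) (X k) (near k)))
                (≤-trans (≤-reflexive (lem₁ (wt w Y))) (+-monoˡ-≤ (wt w Y) (<⇒≤ (≰⇒> outside-heavy)))))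
              (lem₂ (wt w inside) (wt w out)) ≡.refl
              where
              lem₁ : ∀ y → 2 * y ≡ y + y
              lem₁ = solve-∀
              lem₂ : ∀ i o → 2 * (i + o) ≡ 2 * o + 2 * i
              lem₂ = solve-∀

      by-depth : Dec (∃ λ i → Y i ≡ true) → ¬ ¬ Sep E Y w b
      by-depth (no none) = cosets true [] Y (λ i Yi → ⊥-elim (none (i , Yi))) w
      by-depth (yes inhabited) = do
        i , Yi , deepest ← ¬¬-maximum (λ i → Y i ≡ true) depth (sum depth) (λ i _ → term≤sum depth i) inhabited
        at i Yi deepest (t i) ≡.refl

  tree-separated : ∀ {n b} (v : Fin n → Word) → Injective _≡_ _≋_ v →
    (∀ k x Y → (∀ i → Y i ≡ true → InCoset k x (v i)) →
      ∀ w → ¬ ¬ Sep (λ i j → Adj (v i) (v j)) Y w b) →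
    ∀ w → ¬ ¬ Sep (λ i j → Adj (v i) (v j)) full w b
  tree-separated {n} v v-injective cosets w = do
    nf ← ¬¬-∀ λ i → normal-form (v i)
    separate v v-injective cosets (proj₁ ∘ nf) (proj₁ ∘ proj₂ ∘ nf) (proj₂ ∘ proj₂ ∘ nf)
      (suc (card {n} full)) full ≤-refl w

-- Homomorphisms out of and into a free product

module _ (G : Group c₁ ℓ₁) (H : Group c₂ ℓ₂) (P : Group c₃ ℓ₃) where
  open FreeProduct G H renaming (cong to ≋-cong)
  private
    module G = Group G
    module H = Group H
    module P = Group P
  module G→P = MonoidMorphisms G.rawMonoid P.rawMonoid
  module H→P = MonoidMorphisms H.rawMonoid P.rawMonoid
  open MagmaMorphisms (Group.rawMagma group) P.rawMagma using (IsMagmaHomomorphism)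

  -- The map of the universal property; it provides the retractions onto the factors.
  fold : (G.Carrier → P.Carrier) → (H.Carrier → P.Carrier) → Word → P.Carrier
  fold α β []           = P.ε
  fold α β (inj₁ x ∷ w) = α x P.∙ fold α β w
  fold α β (inj₂ y ∷ w) = β y P.∙ fold α β w

  fold-isMagmaHomomorphism : ∀ {α β} → G→P.IsMonoidHomomorphism α → H→P.IsMonoidHomomorphism β →
                             IsMagmaHomomorphism (fold α β)
  fold-isMagmaHomomorphism {α} {β} α-hom β-hom = record
    { isRelHomomorphism = record { cong = fold-cong } ; homo = fold-++ }
    where
    module α = G→P.IsMonoidHomomorphism α-hom
    module β = H→P.IsMonoidHomomorphism β-hom
    fold-++ : ∀ u v → fold α β (u ++ v) P.≈ fold α β u P.∙ fold α β v
    fold-++ []           v = P.sym (P.identityˡ _)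
    fold-++ (inj₁ x ∷ u) v = P.trans (P.∙-congˡ (fold-++ u v)) (P.sym (P.assoc _ _ _))
    fold-++ (inj₂ y ∷ u) v = P.trans (P.∙-congˡ (fold-++ u v)) (P.sym (P.assoc _ _ _))
    fold-cong : ∀ {u v} → u ≋ v → fold α β u P.≈ fold α β v
    fold-cong refl        = P.refl
    fold-cong (sym h)     = P.sym (fold-cong h)
    fold-cong (trans h k) = P.trans (fold-cong h) (fold-cong k)
    fold-cong (≋-cong {u} {u′} {v} {v′} h k) =
      P.trans (fold-++ u v) (P.trans (P.∙-cong (fold-cong h) (fold-cong k)) (P.sym (fold-++ u′ v′)))
    fold-cong (≈-G h)     = P.∙-congʳ (α.⟦⟧-cong h)
    fold-cong (≈-H h)     = P.∙-congʳ (β.⟦⟧-cong h)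
    fold-cong ε-G         = P.trans (P.identityʳ _) α.ε-homo
    fold-cong ε-H         = P.trans (P.identityʳ _) β.ε-homo
    fold-cong (∙-G x y)   = P.trans (P.sym (P.assoc _ _ _)) (P.∙-congʳ (P.sym (α.homo x y)))
    fold-cong (∙-H x y)   = P.trans (P.sym (P.assoc _ _ _)) (P.∙-congʳ (P.sym (β.homo x y)))

trivial-isMonoidHomomorphism : (A : Group c₁ ℓ₁) (B : Group c₂ ℓ₂) →
  MonoidMorphisms.IsMonoidHomomorphism (Group.rawMonoid A) (Group.rawMonoid B) (const (Group.ε B))
trivial-isMonoidHomomorphism A B = record
  { isMagmaHomomorphism = record
    { isRelHomomorphism = record { cong = λ _ → Group.refl B }
    ; homo = λ _ _ → Group.sym B (Group.identityˡ B (Group.ε B)) }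
  ; ε-homo = Group.refl B }

module Factors (G : Group c₁ ℓ₁) (H : Group c₂ ℓ₂) where
  open FreeProduct G H
  private
    module G = Group G
    module H = Group H
  open MagmaMorphisms using (IsMagmaHomomorphism)
  open GroupMorphisms using (IsGroupHomomorphism)

  ιG : G.Carrier → Word
  ιG g = [ inj₁ g ]

  ιH : H.Carrier → Word
  ιH h = [ inj₂ h ]

  ιG-hom : IsGroupHomomorphism G.rawGroup (Group.rawGroup group) ιG
  ιG-hom = record
    { isMonoidHomomorphism = record
      { isMagmaHomomorphism = record
        { isRelHomomorphism = record { cong = ≈-G } ; homo = λ x y → sym (∙-G x y) }
      ; ε-homo = ε-G }
    ; ⁻¹-homo = λ _ → refl }

  ιH-hom : IsGroupHomomorphism H.rawGroup (Group.rawGroup group) ιH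
  ιH-hom = record
    { isMonoidHomomorphism = record
      { isMagmaHomomorphism = record
        { isRelHomomorphism = record { cong = ≈-H } ; homo = λ x y → sym (∙-H x y) }
      ; ε-homo = ε-H }
    ; ⁻¹-homo = λ _ → refl }

  ρG : Word → G.Carrier
  ρG = fold G H G id (const G.ε)

  ρH : Word → H.Carrier
  ρH = fold G H H (const H.ε) id

  ρG-hom : IsMagmaHomomorphism (Group.rawMagma group) G.rawMagma ρG
  ρG-hom = fold-isMagmaHomomorphism G H G (Identity.isMonoidHomomorphism G.rawMonoid G.refl)
                                      (trivial-isMonoidHomomorphism H G)

  ρH-hom : IsMagmaHomomorphism (Group.rawMagma group) H.rawMagma ρH
  ρH-hom = fold-isMagmaHomomorphism G H H (trivial-isMonoidHomomorphism G H)
                                      (Identity.isMonoidHomomorphism H.rawMonoid H.refl)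

  ιG-injective : ∀ {x y} → ιG x ≋ ιG y → x G.≈ y
  ιG-injective h = G.trans (G.sym (G.identityʳ _)) (G.trans (IsMagmaHomomorphism.⟦⟧-cong ρG-hom h) (G.identityʳ _))

  ιH-injective : ∀ {x y} → ιH x ≋ ιH y → x H.≈ y
  ιH-injective h = H.trans (H.sym (H.identityʳ _)) (H.trans (IsMagmaHomomorphism.⟦⟧-cong ρH-hom h) (H.identityʳ _))

module _ (G : Group c₁ ℓ₁) (H : Group c₂ ℓ₂) {I J : Set} (s : I → Group.Carrier G) (t : J → Group.Carrier H) where
  open FreeProduct G H
  open Factors G H
  open NormalForm G H using (colour)
  private
    module G = Group G
    module H = Group H

  letter : I ⊎ J → Letter
  letter (inj₁ i) = inj₁ (s i)
  letter (inj₂ j) = inj₂ (t j)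

  free-product-separated : ∀ {N b} → Adjacency.Separated G s N b → Adjacency.Separated H t N b →
    Adjacency.Separated (G ✶ H) (λ i → [ letter i ]) N b
  free-product-separated separated-G separated-H n≤N v v-injective =
    Tree.tree-separated G H letter v v-injective λ
      { true x Y in-coset → coset-separated G (G ✶ H) ιG-hom ρG-hom (G.identityʳ)
          (λ { (inj₁ i) → inj₁ (i , G.identityʳ _) ; (inj₂ j) → inj₂ (G.identityʳ _) })
          separated-G n≤N v v-injective x Y
          (λ i Yi → G-letter (in-coset i Yi))
      ; false x Y in-coset → coset-separated H (G ✶ H) ιH-hom ρH-hom (H.identityʳ)
          (λ { (inj₁ i) → inj₂ (H.identityʳ _) ; (inj₂ j) → inj₁ (j , H.identityʳ _) })
          separated-H n≤N v v-injective x Y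
          (λ i Yi → H-letter (in-coset i Yi)) }
    where
    G-letter : ∀ {x u} → (∃ λ l → colour l ≡ true × u ≋ x ++ [ l ]) → ∃ λ g → u ≋ x ++ ιG g
    G-letter (inj₁ g , _ , h) = g , h
    H-letter : ∀ {x u} → (∃ λ l → colour l ≡ false × u ≋ x ++ [ l ]) → ∃ λ g → u ≋ x ++ ιH g
    H-letter (inj₂ g , _ , h) = g , h

-- Comparison of the profiles

Separated-mono : (K : Group c₁ ℓ₁) {I : Set} (z : I → Group.Carrier K) → ∀ {N b b′} → b ≤ b′ →
  Adjacency.Separated K z N b → Adjacency.Separated K z N b′
Separated-mono K z b≤b′ separated n≤N v v-injective w = do
  sep ← separated n≤N v v-injective w
  return (Sep-mono b≤b′ inj₂ sep)

module _ (F : Group c₁ ℓ₁) (K : Group c₂ ℓ₂) (S : FiniteGeneratingSet F) where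
  private
    module F = Group F
    module K = Group K
    module S = FiniteGeneratingSet S
  open GroupMorphisms F.rawGroup K.rawGroup using (IsGroupHomomorphism)

  module _ {ι : F.Carrier → K.Carrier} (ι-hom : IsGroupHomomorphism ι) (ι-injective : ∀ {x y} → ι x K.≈ ι y → x F.≈ y)
    {I : Set} (z : I → K.Carrier) (path : ∀ l → Adjacency.Path K z K.ε (ι (S.element l))) where
    open IsGroupHomomorphism ι-hom

    distortion : ℕ
    distortion = Transfer.expansion K z (ι ∘ S.element) path

    -- `ι` places finite subgraphs of `F` injectively in `K`, where paths simulate their edges. This
    -- covers the inclusion of a factor and, with `ι` the identity, a change of generators.
    profile-bound : ∀ {f} → IsSeparationProfile (Cayley F S) f → ∀ {N b} r →
      Adjacency.Separated K z N b → r * distortion ≤ N → f r ≤ distortion * b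
    profile-bound profile r separated r≤N = profile-upper profile r λ Γ Γ≤X order≤r →
      let open _≤ᴳ_ Γ≤X in
      Transfer.transfer K z (ι ∘ S.element) path separated (FiniteGraph._~_ Γ) (ι ∘ embed)
        (injective ∘ ι-injective) (adjacent ∘ edges)
        (≤-trans (*-monoˡ-≤ distortion order≤r) r≤N)
      where
      adjacent : ∀ {x y} → CayleyEdge F S x y → Adjacency.Adj K (ι ∘ S.element) (ι x) (ι y)
      adjacent (_ , i , inj₁ h) = i , inj₁ (K.trans (⟦⟧-cong h) (homo _ _))
      adjacent (_ , i , inj₂ h) = i , inj₂ (K.trans (⟦⟧-cong h) (homo _ _))

theorem1p3 :
    ∀ {c₁ ℓ₁ c₂ ℓ₂} (G : Group c₁ ℓ₁) (H : Group c₂ ℓ₂)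
    (S : FiniteGeneratingSet G) (T : FiniteGeneratingSet H)
    (U : FiniteGeneratingSet (G ✶ H))
    (sepG sepH sepG✶H : ℕ → ℕ) →
    IsSeparationProfile (Cayley G S) sepG →
    IsSeparationProfile (Cayley H T) sepH →
    IsSeparationProfile (Cayley (G ✶ H) U) sepG✶H →
    sepG✶H ≃ (λ r → sepG r ⊔ sepH r)
theorem1p3 G H S T U sepG sepH sepG✶H profileG profileH profileG✶H = upper , lower
  where
  open Factors G H
  open FreeProduct G H using (Letter)
  module S = FiniteGeneratingSet S
  module T = FiniteGeneratingSet T
  module U = FiniteGeneratingSet U
  K = G ✶ H
  -- Used to replace the generators `U` by single letters from `S` and `T`, and to express arbitrary
  -- words by `U`.
  id-hom = Identity.isGroupHomomorphism (Group.rawGroup K) (Group.refl K)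

  ζ : Fin S.size ⊎ Fin T.size → Letter
  ζ = letter G H S.element T.element

  -- In `_≲_` one constant serves both as the factor, where 9M arises, and inside the argument,
  -- where M would do.
  scale : ∀ M r → r * M ≤ 9 * M * r
  scale M r = ≤-trans (≤-reflexive (*-comm r M)) (*-monoˡ-≤ r (m≤m+n M (8 * M)))

  upper : sepG✶H ≲ (λ r → sepG r ⊔ sepH r)
  upper = 9 * M , λ r →
    let N = 9 * M * r
        b = 9 * (sepG N ⊔ sepH N)
    in begin
      sepG✶H r         ≤⟨ profile-bound K K U id-hom id [ζ] word-path profileG✶H r
                            (free-product-separated G H S.element T.element
                              (Separated-mono G S.element (*-monoʳ-≤ 9 (m≤m⊔n (sepG N) (sepH N))) (profile⇒Separated G S profileG N))
                              (Separated-mono H T.element (*-monoʳ-≤ 9 (m≤n⊔m (sepG N) (sepH N))) (profile⇒Separated H T profileH N)))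
                            (scale M r) ⟩
      M * b                                    ≡⟨ lem M (sepG N ⊔ sepH N) ⟩
      9 * M * (sepG N ⊔ sepH N)                ≤⟨ m≤m+n _ (9 * M) ⟩
      9 * M * (sepG N ⊔ sepH N) + 9 * M        ∎
    where
    open ≤-Reasoning
    lem : ∀ M x → M * (9 * x) ≡ 9 * M * x
    lem = solve-∀
    [ζ] = λ i → [ ζ i ]
    open Adjacency K [ζ] using (Path; Path-∙; Path-gen)
    letter-path : ∀ l → Path [] [ l ]
    letter-path (inj₁ g) = Path-generated G K [ζ] ιG-hom (λ i → Path-gen (inj₁ i)) (S.generates g)
    letter-path (inj₂ h) = Path-generated H K [ζ] ιH-hom (λ j → Path-gen (inj₂ j)) (T.generates h)
    path : ∀ w → Path [] w
    path []      = done
    path (l ∷ w) = Path-∙ (letter-path l) (path w)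
    word-path : ∀ i → Path [] (U.element i)
    word-path i = path (U.element i)
    M = distortion K K U id-hom id [ζ] word-path

  lower : (λ r → sepG r ⊔ sepH r) ≲ sepG✶H
  -- The sum dominates the expansions of both factors, so that one constant serves for `sepG` and
  -- `sepH`.
  lower = 9 * (MG + MH) , λ r →
    let N = 9 * (MG + MH) * r
        separated = profile⇒Separated K U profileG✶H N
    in ⊔-lub
      (bound MG (m≤m+n MG MH) r (profile-bound G K S ιG-hom ιG-injective U.element pathG profileG r separated (scale′ MG (m≤m+n MG MH) r)))
      (bound MH (m≤n+m MH MG) r (profile-bound H K T ιH-hom ιH-injective U.element pathH profileH r separated (scale′ MH (m≤n+m MH MG) r)))
    where
    path : ∀ w → Adjacency.Path K U.element [] w
    path w = Path-generated K K U.element id-hom (Adjacency.Path-gen K U.element) (U.generates w)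
    pathG : ∀ i → Adjacency.Path K U.element [] (ιG (S.element i))
    pathG i = path (ιG (S.element i))
    pathH : ∀ j → Adjacency.Path K U.element [] (ιH (T.element j))
    pathH j = path (ιH (T.element j))
    MG = distortion G K S ιG-hom ιG-injective U.element pathG
    MH = distortion H K T ιH-hom ιH-injective U.element pathH
    scale′ : ∀ M → M ≤ MG + MH → ∀ r → r * M ≤ 9 * (MG + MH) * r
    scale′ M M≤ r = ≤-trans (scale M r) (*-monoˡ-≤ r (*-monoʳ-≤ 9 M≤))
    bound : ∀ M → M ≤ MG + MH → ∀ r {x} → x ≤ M * (9 * sepG✶H (9 * (MG + MH) * r)) →
            x ≤ 9 * (MG + MH) * sepG✶H (9 * (MG + MH) * r) + 9 * (MG + MH)
    bound M M≤ r {x} x≤ = begin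
      x                                    ≤⟨ x≤ ⟩
      M * (9 * y)                          ≤⟨ *-monoˡ-≤ (9 * y) M≤ ⟩
      (MG + MH) * (9 * y)                  ≡⟨ lem (MG + MH) y ⟩
      9 * (MG + MH) * y                    ≤⟨ m≤m+n _ (9 * (MG + MH)) ⟩
      9 * (MG + MH) * y + 9 * (MG + MH)    ∎
      where
      open ≤-Reasoning
      y = sepG✶H (9 * (MG + MH) * r)
      lem : ∀ M x → M * (9 * x) ≡ 9 * M * x
      lem = solve-∀
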